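{- Let $k$ be a negative real number, let $g(x)=k$ (a constant polynomial), and let $d(x)$ be a nonconstant polynomial. Let $\{\mathcal{F}_n(x)\}_{n\ge 0}$ and $\{\mathcal{L}_n(x)\}_{n\ge 0}$ be the Fibonacci-type and Lucas-type generalized Fibonacci polynomials determined by $d(x)$ and $g(x)$. Suppose there are real constants $s_1,s_2$ such that $d(s_1)=-\sqrt{ -4k}$ and $d(s_2)=\sqrt{ -4k}$, and such that $4k+d^2(x)\le 0$ for every $x$ in the closed interval with endpoints $s_1$ and $s_2$. Then for all nonnegative integers $n\neq m$, $$\int_{s_1}^{s_2}\mathcal{F}_n(x)\mathcal{F}_m(x)\sqrt{ -4k-d^2(x)}\;d'(x)\,dx=0$$ and $$\int_{s_1}^{s_2}\frac{\mathcal{L}_n(x)\mathcal{L}_m(x)}{\sqrt{ -4k-d^2(x)}}\;d'(x)\,dx=0.$$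
   Context: Generalized Fibonacci polynomials (GFP): fix nonzero polynomials $d(x)\in\mathbb{Q}[x]$ and $g(x)$ with $\deg d>\deg g$ (here $g$ is a real constant). The Fibonacci-type sequence is $\mathcal{F}_0(x)=0$, $\mathcal{F}_1(x)=1$, $\mathcal{F}_n(x)=d(x)\mathcal{F}_{n-1}(x)+g(x)\mathcal{F}_{n-2}(x)$ for $n\ge 2$. The Lucas-type sequence is $\mathcal{L}_0(x)=p_0$, $\mathcal{L}_1(x)=p_1(x)$, $\mathcal{L}_n(x)=d(x)\mathcal{L}_{n-1}(x)+g(x)\mathcal{L}_{n-2}(x)$ for $n\ge2$, where $p_0\in\{\pm1,\pm2\}$, $\alpha=2/p_0$, and $d(x)=\alpha p_1(x)$. Integrals are oriented (if $s_2<s_1$, $\int_{s_1}^{s_2}=-\int_{s_2}^{s_1}$), and the integrand of the second integral is only considered off the finite set where its denominator vanishes. -}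

module Defs where

open import Level using (0ℓ)
open import Algebra.Bundles using (CommutativeRing)
import Algebra.Definitions.RawMonoid as Multiples
import Algebra.Properties.Ring as RingProperties
open import Data.Nat.Base using (ℕ; zero; suc)
open import Data.Integer.Base using (ℤ; +_; -[1+_])
open import Data.Rational.Base using (ℚ; ↥_; ↧ₙ_)
import Data.Rational.Properties as ℚₚ
open import Data.List.Base using (List; []; _∷_; map)
open import Data.Product.Base using (∃; _×_; _,_; proj₁; proj₂)
open import Data.Sum.Base using (_⊎_; inj₁; inj₂)
open import Data.Unit.Base using (⊤)
open import Relation.Nullary using (¬_; yes; no)
open import Relation.Binary.Core using (Rel)
open import Relation.Binary.Structures using (IsDecTotalOrder)
import Relation.Binary.Construct.NonStrictToStrict as ToStrict

-- A polynomial is the list of its coefficients, constant term first.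
-- Trailing zeros are allowed, so equality is _≐_.
module Polynomials {c ℓ} (R : CommutativeRing c ℓ) where
  open CommutativeRing R

  Poly : Set c
  Poly = List Carrier

  coeff : Poly → ℕ → Carrier
  coeff []      _       = 0#
  coeff (a ∷ p) zero    = a
  coeff (a ∷ p) (suc i) = coeff p i

  infix 4 _≐_
  _≐_ : Poly → Poly → Set ℓ
  p ≐ q = ∀ i → coeff p i ≈ coeff q i

  NonConstant : Poly → Set ℓ
  NonConstant p = ∃ λ i → ¬ (coeff p (suc i) ≈ 0#)

  const : Carrier → Poly
  const a = a ∷ []

  infixl 6 _⊞_
  _⊞_ : Poly → Poly → Poly
  []      ⊞ q       = q
  (a ∷ p) ⊞ []      = a ∷ p
  (a ∷ p) ⊞ (b ∷ q) = (a + b) ∷ (p ⊞ q)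

  infixr 8 _⊙_
  _⊙_ : Carrier → Poly → Poly
  a ⊙ p = map (a *_) p

  infixl 7 _⊠_
  _⊠_ : Poly → Poly → Poly
  []      ⊠ q = []
  (a ∷ p) ⊠ q = (a ⊙ q) ⊞ (0# ∷ (p ⊠ q))

  -- (a + X p)′ = p + X p′
  deriv : Poly → Poly
  deriv []      = []
  deriv (a ∷ p) = p ⊞ (0# ∷ deriv p)

  eval : Poly → Carrier → Carrier
  eval []      x = 0#
  eval (a ∷ p) x = a + x * eval p x

  recurrence : (d g : Poly) → (q₀ q₁ : Poly) → ℕ → Poly
  recurrence d g q₀ q₁ zero          = q₀
  recurrence d g q₀ q₁ (suc zero)    = q₁
  recurrence d g q₀ q₁ (suc (suc n)) =
    d ⊠ recurrence d g q₀ q₁ (suc n) ⊞ g ⊠ recurrence d g q₀ q₁ n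

  fibonacci : (d g : Poly) → ℕ → Poly
  fibonacci d g = recurrence d g (const 0#) (const 1#)

  lucas : (d g : Poly) (p₀ : Carrier) (p₁ : Poly) → ℕ → Poly
  lucas d g p₀ p₁ = recurrence d g (const p₀) p₁

module ℚ[x] = Polynomials ℚₚ.+-*-commutativeRing

-- The real numbers, characterised (uniquely up to isomorphism) as a
-- Dedekind-complete ordered field.  The reals meant are those of classical
-- mathematics: the order is decidable, and the supremum σ of S comes with
-- the approximation property "every y < σ lies below some element of S",
-- which classically is equivalent to σ being the least upper bound.
record Reals : Set₁ where
  infix 4 _≤_
  field
    commutativeRing : CommutativeRing 0ℓ 0ℓ
  open CommutativeRing commutativeRing public
  field
    _≤_             : Rel Carrier 0ℓ
    isDecTotalOrder : IsDecTotalOrder _≈_ _≤_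
  open IsDecTotalOrder isDecTotalOrder public
    using (_≟_; _≤?_; total; antisym; ≤-respˡ-≈; ≤-respʳ-≈)
    renaming (refl to ≤-refl; reflexive to ≤-reflexive; trans to ≤-trans)
  open ToStrict _≈_ _≤_ public using (_<_)
  field
    1≉0     : ¬ (1# ≈ 0#)
    inverse : ∀ x → ¬ (x ≈ 0#) → ∃ λ y → x * y ≈ 1#
    +-monoˡ : ∀ {x y} z → x ≤ y → x + z ≤ y + z
    *-nonneg : ∀ {x y} → 0# ≤ x → 0# ≤ y → 0# ≤ x * y

  UpperBound : (Carrier → Set) → Carrier → Set
  UpperBound S u = ∀ x → S x → x ≤ u

  IsSupremum : (Carrier → Set) → Carrier → Set
  IsSupremum S σ = UpperBound S σ × (∀ y → y < σ → ∃ λ x → S x × y < x)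

  field
    supremum : (S : Carrier → Set) → ∃ S → ∃ (UpperBound S) → ∃ (IsSupremum S)

module Analysis (ℝ : Reals) where
  open Reals ℝ
  open RingProperties ring using (-‿distribˡ-*; -‿distribʳ-*; -‿involutive)
  open Multiples +-rawMonoid public using () renaming (_×_ to _·_)
  open Polynomials commutativeRing public

  -- Total by the convention 0⁻¹ = 0.
  infix 9 _⁻¹
  _⁻¹ : Carrier → Carrier
  x ⁻¹ with x ≟ 0#
  ... | yes _  = 0#
  ... | no x≉0 = proj₁ (inverse x x≉0)

  fromℤ : ℤ → Carrier
  fromℤ (+ n)    = n · 1#
  fromℤ -[1+ n ] = - (suc n · 1#)

  fromℚ : ℚ → Carrier
  fromℚ q = fromℤ (↥ q) * (↧ₙ q · 1#) ⁻¹

  fromℚ[x] : ℚ[x].Poly → Poly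
  fromℚ[x] = map fromℚ

  private
    +-monoʳ : ∀ {x y} z → x ≤ y → z + x ≤ z + y
    +-monoʳ z x≤y =
      ≤-respˡ-≈ (+-comm _ z) (≤-respʳ-≈ (+-comm _ z) (+-monoˡ z x≤y))

    x≤y⇒0≤y-x : ∀ {x y} → x ≤ y → 0# ≤ y - x
    x≤y⇒0≤y-x {x} x≤y = ≤-respˡ-≈ (-‿inverseʳ x) (+-monoˡ (- x) x≤y)

    0≤y-x⇒x≤y : ∀ {x y} → 0# ≤ y - x → x ≤ y
    0≤y-x⇒x≤y {x} {y} 0≤y-x = ≤-respˡ-≈ (+-identityˡ x) (≤-respʳ-≈
      (trans (+-assoc y (- x) x) (trans (+-congˡ (-‿inverseˡ x)) (+-identityʳ y)))
      (+-monoˡ x 0≤y-x))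

    0≤1 : 0# ≤ 1#
    0≤1 with total 0# 1#
    ... | inj₁ p = p
    ... | inj₂ 1≤0 = ≤-respʳ-≈ -1*-1≈1 (*-nonneg 0≤-1 0≤-1)
      where
      0≤-1 : 0# ≤ - 1#
      0≤-1 = ≤-respʳ-≈ (+-identityˡ (- 1#)) (x≤y⇒0≤y-x 1≤0)
      -1*-1≈1 : - 1# * - 1# ≈ 1#
      -1*-1≈1 = trans (sym (-‿distribˡ-* 1# (- 1#)))
                  (trans (-‿cong (*-identityˡ (- 1#))) (-‿involutive 1#))

    x≤1+x : ∀ x → x ≤ 1# + x
    x≤1+x x = ≤-respˡ-≈ (+-identityˡ x) (+-monoˡ x 0≤1)

    1≤y⇒y≤y*y : ∀ {y} → 1# ≤ y → y ≤ y * y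
    1≤y⇒y≤y*y {y} 1≤y = 0≤y-x⇒x≤y (≤-respʳ-≈
      (trans (distribˡ y y (- 1#)) (+-congˡ
        (trans (sym (-‿distribʳ-* y 1#)) (-‿cong (*-identityʳ y)))))
      (*-nonneg (≤-trans 0≤1 1≤y) (x≤y⇒0≤y-x 1≤y)))

    √-bound : ∀ {x} → 0# ≤ x → UpperBound (λ y → y * y ≤ x) (1# + x)
    √-bound {x} 0≤x y y²≤x with total y (1# + x)
    ... | inj₁ y≤1+x = y≤1+x
    ... | inj₂ 1+x≤y = ≤-trans (1≤y⇒y≤y*y 1≤y) (≤-trans y²≤x (x≤1+x x))
      where
      1≤y : 1# ≤ y
      1≤y = ≤-trans (≤-respˡ-≈ (+-identityʳ 1#) (+-monoʳ 1# 0≤x)) 1+x≤y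

  -- √ x = sup { y ∣ y² ≤ x } for x ≥ 0, with the junk value 0 for x < 0.
  infix 9 √_
  √_ : Carrier → Carrier
  √ x with 0# ≤? x
  ... | no _    = 0#
  ... | yes 0≤x = proj₁ (supremum (λ y → y * y ≤ x)
                    (0# , ≤-respˡ-≈ (sym (zeroˡ 0#)) 0≤x)
                    (1# + x , √-bound 0≤x))

  Within : Carrier → Carrier → Carrier → Set
  Within ε x y = x - y < ε × y - x < ε

  -- x lies in the closed interval with endpoints s and t, in either order.
  Between : Carrier → Carrier → Carrier → Set
  Between s t x = (s ≤ x × x ≤ t) ⊎ (t ≤ x × x ≤ s)

  -- Tagged partitions of [a , b]: in step t y P the first subinterval is
  -- [a , y], its tag is t, and P partitions [y , b].
  data Tagged (a b : Carrier) : Set where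
    done : a ≈ b → Tagged a b
    step : ∀ t y → a ≤ t → t ≤ y → Tagged y b → Tagged a b

  MeshBelow : ∀ {a b} → Carrier → Tagged a b → Set
  MeshBelow         δ (done _)         = ⊤
  MeshBelow {a = a} δ (step _ y _ _ P) = y - a < δ × MeshBelow δ P

  riemannSum : ∀ {a b} → (Carrier → Carrier) → Tagged a b → Carrier
  riemannSum         f (done _)         = 0#
  riemannSum {a = a} f (step t y _ _ P) = f t * (y - a) + riemannSum f P

  -- For a ≤ b: f is Riemann integrable on [a , b] with integral I.
  Riemann : (f : Carrier → Carrier) (a b I : Carrier) → Set
  Riemann f a b I =
    ∀ ε → 0# < ε → ∃ λ δ → 0# < δ ×
      (∀ (P : Tagged a b) → MeshBelow δ P → Within ε (riemannSum f P) I)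

  -- For a < b: f is Riemann integrable on every [u , v] with a < u ≤ v < b,
  -- and the integrals tend to I as u → a⁺ and v → b⁻.
  OpenImproper : (f : Carrier → Carrier) (a b I : Carrier) → Set
  OpenImproper f a b I =
    (∀ u v → a < u → u ≤ v → v < b → ∃ (Riemann f u v)) ×
    (∀ ε → 0# < ε → ∃ λ δ → 0# < δ ×
      (∀ u v J → a < u → u < a + δ → u ≤ v → b - δ < v → v < b →
        Riemann f u v J → Within ε J I))

  -- The improper Riemann integral over [a , b] of a function f considered
  -- only on the set D: finitely many points a = x₀ < x₁ < … < xᵣ = b cut
  -- [a , b] into open intervals contained in D, on each of which f has an
  -- improper integral, and I is the sum of these.
  data Improper (D : Carrier → Set) (f : Carrier → Carrier) (a b I : Carrier) : Set where
    done : a ≈ b → I ≈ 0# → Improper D f a b I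
    step : ∀ c J K → a < c → (∀ x → a < x → x < c → D x) →
           OpenImproper f a c J → Improper D f c b K → I ≈ J + K →
           Improper D f a b I

  Oriented : (Carrier → Carrier → Carrier → Set) → (s t I : Carrier) → Set
  Oriented Integral s t I =
    (s ≤ t × Integral s t I) ⊎ (t ≤ s × Integral t s (- I))

  infix 4 ∫[_,_]_≈_
  ∫[_,_]_≈_ : (s t : Carrier) (f : Carrier → Carrier) (I : Carrier) → Set
  ∫[ s , t ] f ≈ I = Oriented (Riemann f) s t I

  infix 4 ∫[_,_]_off-zeros-of_≈_
  ∫[_,_]_off-zeros-of_≈_ : (s t : Carrier) (f q : Carrier → Carrier) (I : Carrier) → Set
  ∫[ s , t ] f off-zeros-of q ≈ I =
    Oriented (Improper (λ x → ¬ (q x ≈ 0#)) f) s t I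

{-# OPTIONS --safe #-}

-- Put y = d(x), w = √(−4k − y²), and let Fₙ, Vₙ be the Fibonacci- and
-- Lucas-type sequences as functions of y (with V₀ = 2, so that 2 𝓛ₙ = p₀ Vₙ).
-- Fₙ solves w² F″ − 3 y F′ + (n² − 1) F = 0, and Vₙ′ = n Fₙ, w² Fₙ′ = y Fₙ − n Vₙ.
-- Hence
--   (w³ (Fₙ′ Fₘ − Fₙ Fₘ′))′ = (m² − n²) w Fₙ Fₘ,
--   (w (n Fₙ Vₘ − m Fₘ Vₙ))′ = (m² − n²) Vₙ Vₘ / w.
-- Both antiderivatives vanish at s₁ and s₂, where w = 0.  In the first, w³ is
-- differentiable even at the zeros of w.  In the second, w is differentiable
-- only away from them; they are zeros of the nonzero polynomials √(−4k) ± d,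
-- hence finitely many, and the antiderivative is continuous across them.
module Submission where

-- Up to scaling, `F` and `V` are the Chebyshev polynomials of the second and first kind. The two
-- antiderivatives come from Lagrange's identity for the self-adjoint equations (w³ F′)′ = (1 - n²)
-- w F and (w V′)′ = - n² V / w. No substitution y = d(x) is made, because d need not be monotone
-- between s₁ and s₂: everything is composed with d and differentiated in x.
--
-- Differentiability is uniform by definition: a difference quotient approaches the derivative at
-- any tag between its ends, at a rate that does not depend on the place. Sums, products and the
-- fundamental theorem then require no mean value theorem. The price is paid by the square root,
-- which is uniformly differentiable only where it stays above a positive constant; this is why the
-- first weight is handled through w³ as a whole, and the second on closed subintervals free of
-- zeros. Compactness enters only for that positive constant and for the existence of fine
-- partitions, on which the uniqueness of integrals rests.

open import Defs
open import Algebra.Bundles using (CommutativeRing; RawRing)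
import Algebra.Solver.Ring as AlmostCommutativeRingSolver
open import Data.Empty using (⊥; ⊥-elim)
open import Data.List.Base using ([]; _∷_; length)
open import Data.Maybe.Base using (Maybe; nothing; map)
open import Data.Nat as ℕ using (ℕ; zero; suc)
import Data.Nat.Properties as ℕₚ
open import Data.Product.Base using (∃; ∃-syntax; _×_; _,_; proj₁; proj₂; swap)
open import Data.Product.Properties using (≡-dec)
open import Data.Sum.Base using (_⊎_; inj₁; inj₂)
open import Data.Unit.Base using (tt)
open import Relation.Binary.Bundles using (DecTotalOrder)
open import Relation.Binary.Consequences using (dec⇒weaklyDec)
import Relation.Binary.Construct.NonStrictToStrict as ToStrict
import Relation.Binary.Properties.DecTotalOrder as DecTotalOrderProperties
open import Relation.Binary.PropositionalEquality.Core as ≡ using (_≡_; _≢_)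
open import Relation.Nullary using (¬_; yes; no)

-- Coefficients are differences a − b of natural numbers, reduced so that one
-- of a, b is 0: the solver then cancels although the ring is abstract.
module RingSolver {c ℓ} (R : CommutativeRing c ℓ) where
  open CommutativeRing R hiding (zero)
  open import Algebra.Solver.Ring.AlmostCommutativeRing
    using (fromCommutativeRing; _-Raw-AlmostCommutative⟶_; -raw-almostCommutative⟶)
  open import Algebra.Properties.Semiring.Mult.TCOptimised semiring
    using (×-homo-+; ×1-homo-*) renaming (_×_ to _·ₒ_)
  open import Algebra.Properties.Ring ring
    using (-0#≈0#; -‿+-comm; -‿distribˡ-*; -‿distribʳ-*; -‿involutive)
  open import Relation.Binary.Reasoning.Setoid setoid

  private
    -- With coefficients in the ring itself and no equality test, this solver can rearrange but not
    -- cancel. It serves only to establish that `value` is a homomorphism.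
    module NoCancellation = AlmostCommutativeRingSolver
      (CommutativeRing.rawRing R) (fromCommutativeRing R)
      (-raw-almostCommutative⟶ (fromCommutativeRing R)) (λ _ _ → nothing)

    reduce : ℕ → ℕ → ℕ × ℕ
    reduce a b = a ℕ.∸ b , b ℕ.∸ a

    differences : RawRing _ _
    differences = record
      { Carrier = ℕ × ℕ
      ; _≈_     = _≡_
      ; _+_     = λ { (a , b) (c , d) → reduce (a ℕ.+ c) (b ℕ.+ d) }
      ; _*_     = λ { (a , b) (c , d) → reduce (a ℕ.* c ℕ.+ b ℕ.* d) (a ℕ.* d ℕ.+ b ℕ.* c) }
      ; -_      = swap
      ; 0#      = 0 , 0
      ; 1#      = 1 , 0
      }

    -- The separate case b = 0 and the optimised multiples send the coefficients 0 and 1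
    -- definitionally to `0#` and `1#`, so that solved equations match goals written with these
    -- constants.
    value : ℕ × ℕ → Carrier
    value (a , zero)      = a ·ₒ 1#
    value (a , b@(suc _)) = a ·ₒ 1# - b ·ₒ 1#

    value≈ : ∀ a b → value (a , b) ≈ a ·ₒ 1# - b ·ₒ 1#
    value≈ a zero    = sym (trans (+-congˡ -0#≈0#) (+-identityʳ _))
    value≈ a (suc b) = refl

    value-reduce : ∀ a b → value (reduce a b) ≈ a ·ₒ 1# - b ·ₒ 1#
    value-reduce zero    zero    = value≈ zero zero
    value-reduce zero    (suc b) = value≈ zero (suc b)
    value-reduce (suc a) zero    = value≈ (suc a) zero
    value-reduce (suc a) (suc b) = trans (value-reduce a b) (sym (begin
      suc a ·ₒ 1# - suc b ·ₒ 1#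
        ≈⟨ +-cong (×-homo-+ 1# 1 a) (-‿cong (×-homo-+ 1# 1 b)) ⟩
      (1# + a ·ₒ 1#) - (1# + b ·ₒ 1#)
        ≈⟨ +-cong (+-comm _ _) (sym (-‿+-comm 1# (b ·ₒ 1#))) ⟩
      (a ·ₒ 1# + 1#) + (- 1# - b ·ₒ 1#)
        ≈⟨ (let open NoCancellation in
            solve 4 (λ a b p m → (a :+ p) :+ (m :+ b) := (p :+ m) :+ (a :+ b)) refl) _ _ _ _ ⟩
      (1# - 1#) + (a ·ₒ 1# - b ·ₒ 1#)
        ≈⟨ trans (+-congʳ (-‿inverseʳ 1#)) (+-identityˡ _) ⟩
      a ·ₒ 1# - b ·ₒ 1# ∎))

    value-+ : ∀ p q → value (RawRing._+_ differences p q) ≈ value p + value q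
    value-+ (a , b) (c , d) = begin
      value (reduce (a ℕ.+ c) (b ℕ.+ d))
        ≈⟨ value-reduce (a ℕ.+ c) (b ℕ.+ d) ⟩
      (a ℕ.+ c) ·ₒ 1# - (b ℕ.+ d) ·ₒ 1#
        ≈⟨ +-cong (×-homo-+ 1# a c) (-‿cong (×-homo-+ 1# b d)) ⟩
      (a ·ₒ 1# + c ·ₒ 1#) - (b ·ₒ 1# + d ·ₒ 1#)
        ≈⟨ (let open NoCancellation in
            solve 4 (λ a b c d → (a :+ c) :- (b :+ d) := (a :- b) :+ (c :- d)) refl) _ _ _ _ ⟩
      (a ·ₒ 1# - b ·ₒ 1#) + (c ·ₒ 1# - d ·ₒ 1#)
        ≈⟨ +-cong (value≈ a b) (value≈ c d) ⟨
      value (a , b) + value (c , d) ∎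

    value-* : ∀ p q → value (RawRing._*_ differences p q) ≈ value p * value q
    value-* (a , b) (c , d) = begin
      value (reduce (a ℕ.* c ℕ.+ b ℕ.* d) (a ℕ.* d ℕ.+ b ℕ.* c))
        ≈⟨ value-reduce (a ℕ.* c ℕ.+ b ℕ.* d) (a ℕ.* d ℕ.+ b ℕ.* c) ⟩
      (a ℕ.* c ℕ.+ b ℕ.* d) ·ₒ 1# - (a ℕ.* d ℕ.+ b ℕ.* c) ·ₒ 1#
        ≈⟨ +-cong (homo a c b d) (-‿cong (homo a d b c)) ⟩
      (a ·ₒ 1# * c ·ₒ 1# + b ·ₒ 1# * d ·ₒ 1#) - (a ·ₒ 1# * d ·ₒ 1# + b ·ₒ 1# * c ·ₒ 1#)
        ≈⟨ crossTerms _ _ _ _ ⟩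
      (a ·ₒ 1# - b ·ₒ 1#) * (c ·ₒ 1# - d ·ₒ 1#)
        ≈⟨ *-cong (value≈ a b) (value≈ c d) ⟨
      value (a , b) * value (c , d) ∎
      where
      homo : ∀ a b c d → (a ℕ.* b ℕ.+ c ℕ.* d) ·ₒ 1# ≈ a ·ₒ 1# * b ·ₒ 1# + c ·ₒ 1# * d ·ₒ 1#
      homo a b c d = trans (×-homo-+ 1# (a ℕ.* b) (c ℕ.* d))
                           (+-cong (×1-homo-* a b) (×1-homo-* c d))
      crossTerms : ∀ a b c d → (a * c + b * d) - (a * d + b * c) ≈ (a - b) * (c - d)
      crossTerms a b c d = begin
        (a * c + b * d) - (a * d + b * c)
          ≈⟨ +-cong (+-congˡ neg*neg) (-‿+-comm (a * d) (b * c)) ⟨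
        (a * c + - b * - d) + (- (a * d) - b * c)
          ≈⟨ +-congˡ (+-cong (-‿distribʳ-* a d) (-‿distribˡ-* b c)) ⟩
        (a * c + - b * - d) + (a * - d + - b * c)
          ≈⟨ (let open NoCancellation in
              solve 4 (λ a b c d → (a :* c :+ b :* d) :+ (a :* d :+ b :* c)
                                := (a :+ b) :* (c :+ d)) refl) _ _ _ _ ⟩
        (a - b) * (c - d) ∎
        where
        neg*neg : - b * - d ≈ b * d
        neg*neg = trans (sym (-‿distribˡ-* b (- d)))
          (trans (-‿cong (sym (-‿distribʳ-* b d))) (-‿involutive _))

    value-neg : ∀ p → value (swap p) ≈ - value p
    value-neg (a , b) = begin
      value (b , a)                  ≈⟨ value≈ b a ⟩
      b ·ₒ 1# - a ·ₒ 1#              ≈⟨ +-comm _ _ ⟩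
      - (a ·ₒ 1#) + b ·ₒ 1#          ≈⟨ +-congˡ (-‿involutive _) ⟨
      - (a ·ₒ 1#) - - (b ·ₒ 1#)      ≈⟨ -‿+-comm _ _ ⟩
      - (a ·ₒ 1# - b ·ₒ 1#)          ≈⟨ -‿cong (value≈ a b) ⟨
      - value (a , b)                ∎

    valueMorphism : differences -Raw-AlmostCommutative⟶ fromCommutativeRing R
    valueMorphism = record
      { ⟦_⟧    = value
      ; +-homo = value-+
      ; *-homo = value-*
      ; -‿homo = value-neg
      ; 0-homo = refl
      ; 1-homo = refl
      }

    value-cong : ∀ p q → Maybe (value p ≈ value q)
    value-cong p q = map (λ { ≡.refl → refl }) (dec⇒weaklyDec (≡-dec ℕ._≟_ ℕ._≟_) p q)

  open AlmostCommutativeRingSolver differences (fromCommutativeRing R) valueMorphism value-cong public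
    using (Polynomial; solve; _:=_; _:+_; _:*_; _:-_; :-_; con)

  infixr 9 _:·_
  -- Unfolds in the same way as `_·_`, so that `4 :· k` evaluates to `4 · k` itself.
  _:·_ : ∀ {n} → ℕ → Polynomial n → Polynomial n
  zero  :· e = con (0 , 0)
  suc n :· e = e :+ n :· e

  :0 :1 : ∀ {n} → Polynomial n
  :0 = con (0 , 0)
  :1 = con (1 , 0)

-- Ordered fields: inequalities, inverses, bounds on absolute values.

module OrderedField (ℝ : Reals) where
  open Reals ℝ hiding (zero)
  open Analysis ℝ
  open RingSolver commutativeRing

  decTotalOrder : DecTotalOrder _ _ _
  decTotalOrder = record { isDecTotalOrder = isDecTotalOrder }

  open DecTotalOrderProperties decTotalOrder public
    using (≰⇒>; <⇒≱; ≰⇒≥)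
  open import Relation.Binary.Construct.NonStrictToStrict _≈_ _≤_ public
    using (<⇒≤)
  abstract
    <-≤-trans : ∀ {x y z} → x < y → y ≤ z → x < z
    <-≤-trans = ToStrict.<-≤-trans _≈_ _≤_ sym ≤-trans antisym ≤-respʳ-≈
      where import Relation.Binary.Construct.NonStrictToStrict as ToStrict

    ≤-<-trans : ∀ {x y z} → x ≤ y → y < z → x < z
    ≤-<-trans = ToStrict.≤-<-trans _≈_ _≤_ ≤-trans antisym ≤-respˡ-≈
      where import Relation.Binary.Construct.NonStrictToStrict as ToStrict

    <-respˡ-≈ : ∀ {x y z} → x ≈ y → x < z → y < z
    <-respˡ-≈ e p = ≤-<-trans (≤-reflexive (sym e)) p

    <-respʳ-≈ : ∀ {x y z} → x ≈ y → z < x → z < y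
    <-respʳ-≈ e p = <-≤-trans p (≤-reflexive e)

    ≤-resp : ∀ {x y u v} → x ≈ u → y ≈ v → x ≤ y → u ≤ v
    ≤-resp p q r = ≤-respˡ-≈ p (≤-respʳ-≈ q r)

    +-mono-≤ : ∀ {x y u v} → x ≤ y → u ≤ v → x + u ≤ y + v
    +-mono-≤ {x} {y} {u} {v} p q = ≤-trans (+-monoˡ u p)
      (≤-resp (+-comm u y) (+-comm v y) (+-monoˡ y q))

    0≤y-x⇒x≤y : ∀ {x y} → 0# ≤ y - x → x ≤ y
    0≤y-x⇒x≤y {x} {y} p = ≤-resp (+-identityˡ x)
      (solve 2 (λ x y → y :- x :+ x := y) refl x y) (+-monoˡ x p)

    x≤y⇒0≤y-x : ∀ {x y} → x ≤ y → 0# ≤ y - x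
    x≤y⇒0≤y-x {x} {y} p = ≤-respˡ-≈ (-‿inverseʳ x) (+-monoˡ (- x) p)

    -- x ≤ y is proved by exhibiting y − x as a combination of nonnegative terms.
    by-≤ : ∀ {x y e} → 0# ≤ e → y - x ≈ e → x ≤ y
    by-≤ p eq = 0≤y-x⇒x≤y (≤-respʳ-≈ (sym eq) p)

    by-< : ∀ {x y e} → 0# < e → y - x ≈ e → x < y
    by-< {x} {y} (p , 0≉e) eq = by-≤ p eq ,
      λ x≈y → 0≉e (trans (sym (-‿inverseʳ x)) (trans (+-congʳ x≈y) eq))

    x<y⇒0<y-x : ∀ {x y} → x < y → 0# < y - x
    x<y⇒0<y-x {x} {y} (p , x≉y) = x≤y⇒0≤y-x p , λ e → x≉y
      (trans (sym (+-identityˡ x)) (trans (+-congʳ e)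
        (solve 2 (λ x y → y :- x :+ x := y) refl x y)))

    +-nonneg : ∀ {x y} → 0# ≤ x → 0# ≤ y → 0# ≤ x + y
    +-nonneg p q = ≤-respˡ-≈ (+-identityˡ 0#) (+-mono-≤ p q)

    +-pos : ∀ {x y} → 0# < x → 0# ≤ y → 0# < x + y
    +-pos {x} {y} p q = <-≤-trans p (by-≤ q (solve 2 (λ x y → x :+ y :- x := y) refl x y))

    +-posʳ : ∀ {x y} → 0# ≤ x → 0# < y → 0# < x + y
    +-posʳ p q = <-respʳ-≈ (+-comm _ _) (+-pos q p)

    integral : ∀ {x y} → x * y ≈ 0# → ¬ (x ≈ 0#) → y ≈ 0#
    integral {x} {y} xy≈0 x≉0 with inverse x x≉0
    ... | z , xz≈1 = trans (sym (*-identityˡ y)) (trans (*-congʳ (sym xz≈1))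
      (trans (solve 3 (λ x y z → x :* z :* y := z :* (x :* y)) refl x y z)
        (trans (*-congˡ xy≈0) (zeroʳ z))))

    *-pos : ∀ {x y} → 0# < x → 0# < y → 0# < x * y
    *-pos (p , 0≉x) (q , 0≉y) = *-nonneg p q , λ e →
      0≉y (sym (integral (sym e) λ x≈0 → 0≉x (sym x≈0)))

    pos⇒≉0 : ∀ {x} → 0# < x → ¬ (x ≈ 0#)
    pos⇒≉0 (_ , 0≉x) e = 0≉x (sym e)

    square-nonneg : ∀ x → 0# ≤ x * x
    square-nonneg x with total 0# x
    ... | inj₁ p = *-nonneg p p
    ... | inj₂ p = ≤-respʳ-≈ (solve 1 (λ x → (:0 :- x) :* (:0 :- x) := x :* x) refl x)
      (*-nonneg (x≤y⇒0≤y-x p) (x≤y⇒0≤y-x p))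

    0<1 : 0# < 1#
    0<1 = ≤-respʳ-≈ (*-identityˡ 1#) (square-nonneg 1#) , λ e → 1≉0 (sym e)

    0≤1 : 0# ≤ 1#
    0≤1 = <⇒≤ 0<1

    zero? : ∀ x → x ≈ 0# ⊎ ¬ (x ≈ 0#)
    zero? x with x ≟ 0#
    ... | yes e = inj₁ e
    ... | no ne = inj₂ ne

    0<2 : 0# < 1# + 1#
    0<2 = +-pos 0<1 0≤1

    ⁻¹-inverseʳ : ∀ {x} → ¬ (x ≈ 0#) → x * x ⁻¹ ≈ 1#
    ⁻¹-inverseʳ {x} x≉0 with x ≟ 0#
    ... | yes x≈0 = ⊥-elim (x≉0 x≈0)
    ... | no x≉0  = proj₂ (inverse x x≉0)

    0⁻¹ : ∀ {x} → x ≈ 0# → x ⁻¹ ≈ 0#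
    0⁻¹ {x} x≈0 with x ≟ 0#
    ... | yes _  = refl
    ... | no x≉0 = ⊥-elim (x≉0 x≈0)

    *-cancelˡ : ∀ {x y z} → ¬ (x ≈ 0#) → x * y ≈ x * z → y ≈ z
    *-cancelˡ {x} {y} {z} x≉0 e = trans (lemma y) (trans (*-congˡ e) (sym (lemma z)))
      where
      lemma : ∀ y → y ≈ x ⁻¹ * (x * y)
      lemma y = trans (sym (*-identityˡ y)) (trans (*-congʳ (sym (⁻¹-inverseʳ x≉0)))
        (solve 3 (λ x y z → x :* z :* y := z :* (x :* y)) refl x y (x ⁻¹)))

    ⁻¹-pos : ∀ {x} → 0# < x → 0# < x ⁻¹
    ⁻¹-pos {x} p with 0# ≤? x ⁻¹
    ... | yes q = q , λ e → 1≉0 (trans (sym (⁻¹-inverseʳ (pos⇒≉0 p)))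
                                  (trans (*-congˡ (sym e)) (zeroʳ x)))
    ... | no ¬q = ⊥-elim (<⇒≱ 0<1 (by-≤ (*-nonneg (<⇒≤ p) (x≤y⇒0≤y-x (≰⇒≥ ¬q)))
        (trans (+-congˡ (-‿cong (sym (⁻¹-inverseʳ (pos⇒≉0 p)))))
          (solve 2 (λ x i → :0 :- x :* i := x :* (:0 :- i)) refl x (x ⁻¹)))))

  infixl 7 _÷_
  _÷_ : Carrier → Carrier → Carrier
  x ÷ y = x * y ⁻¹

  abstract
    ÷-cancel : ∀ x {y} → 0# < y → x ÷ y * y ≈ x
    ÷-cancel x {y} p = trans (solve 3 (λ x y i → x :* i :* y := x :* (y :* i)) refl x y (y ⁻¹))
      (trans (*-congˡ (⁻¹-inverseʳ (pos⇒≉0 p))) (*-identityʳ x))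

    ÷-pos : ∀ {x y} → 0# < x → 0# < y → 0# < x ÷ y
    ÷-pos p q = *-pos p (⁻¹-pos q)

    *-cancelˡ-≤0 : ∀ {x y} → 0# < x → 0# ≤ x * y → 0# ≤ y
    *-cancelˡ-≤0 {x} {y} p q with 0# ≤? y
    ... | yes r = r
    ... | no ¬r = ⊥-elim (<⇒≱ (*-pos p (x<y⇒0<y-x (≰⇒> ¬r)))
        (by-≤ q (solve 2 (λ x y → :0 :- x :* (:0 :- y) := x :* y) refl x y)))

  -- Absolute values enter only through the relation |x| ≤ y.
  record ∣_∣≤_ (x y : Carrier) : Set where
    constructor mk
    field
      upper : x ≤ y
      lower : - x ≤ y
  infix 4 ∣_∣≤_
  open ∣_∣≤_ public

  abstract
    abs-resp : ∀ {x y u v} → x ≈ u → y ≈ v → ∣ x ∣≤ y → ∣ u ∣≤ v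
    abs-resp p q (mk a b) = mk (≤-resp p q a) (≤-resp (-‿cong p) q b)

    abs-+ : ∀ {x y u v} → ∣ x ∣≤ u → ∣ y ∣≤ v → ∣ x + y ∣≤ u + v
    abs-+ {x} {y} (mk a b) (mk c d) = mk (+-mono-≤ a c)
      (≤-respˡ-≈ (solve 2 (λ x y → :- x :+ :- y := :- (x :+ y)) refl x y) (+-mono-≤ b d))

    abs-neg : ∀ {x u} → ∣ x ∣≤ u → ∣ - x ∣≤ u
    abs-neg {x} (mk a b) = mk b (≤-respˡ-≈ (solve 1 (λ x → x := :- :- x) refl x) a)

    abs-swap : ∀ {x y u} → ∣ x - y ∣≤ u → ∣ y - x ∣≤ u
    abs-swap {x} {y} p =
      abs-resp (solve 2 (λ x y → :- (x :- y) := y :- x) refl x y) refl (abs-neg p)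

    abs-0 : ∀ {u} → 0# ≤ u → ∣ 0# ∣≤ u
    abs-0 p = mk p (≤-respˡ-≈ (solve 0 (:0 := :- :0) refl) p)

    abs-* : ∀ {x y u v} → ∣ x ∣≤ u → ∣ y ∣≤ v → ∣ x * y ∣≤ u * v
    abs-* {x} {y} {u} {v} (mk a b) (mk c d) = mk
      (halve (+-nonneg (*-nonneg (x≤y⇒0≤y-x a) (x≤y⇒0≤y-x d))
                       (*-nonneg (x≤y⇒0≤y-x b) (x≤y⇒0≤y-x c)))
        (solve 4 (λ x y u v → (u :- x) :* (v :- :- y) :+ (u :- :- x) :* (v :- y)
          := (:1 :+ :1) :* (u :* v :- x :* y)) refl x y u v))
      (halve (+-nonneg (*-nonneg (x≤y⇒0≤y-x a) (x≤y⇒0≤y-x c))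
                       (*-nonneg (x≤y⇒0≤y-x b) (x≤y⇒0≤y-x d)))
        (solve 4 (λ x y u v → (u :- x) :* (v :- y) :+ (u :- :- x) :* (v :- :- y)
          := (:1 :+ :1) :* (u :* v :- :- (x :* y))) refl x y u v))
      where
      halve : ∀ {e p q} → 0# ≤ e → e ≈ (1# + 1#) * (q - p) → p ≤ q
      halve p eq = 0≤y-x⇒x≤y (*-cancelˡ-≤0 0<2 (≤-respʳ-≈ eq p))

    square-mono⁻¹ : ∀ {x y} → 0# ≤ y → x * x ≤ y * y → x ≤ y
    square-mono⁻¹ {x} {y} 0≤y p with x ≤? y
    ... | yes q = q
    ... | no ¬q = ⊥-elim (<⇒≱ (*-pos (x<y⇒0<y-x (≰⇒> ¬q)) (+-pos (≤-<-trans 0≤y (≰⇒> ¬q)) 0≤y))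
        (by-≤ (x≤y⇒0≤y-x p)
          (solve 2 (λ x y → :0 :- (x :- y) :* (x :+ y) := y :* y :- x :* x) refl x y)))

-- Completeness: square roots, excluded middle, Cousin's lemma.

module Completeness (ℝ : Reals) where
  open Reals ℝ hiding (zero)
  open Analysis ℝ
  open RingSolver commutativeRing
  open OrderedField ℝ

  abstract
    √-nonneg : ∀ x → 0# ≤ √ x
    √-nonneg x with 0# ≤? x
    ... | no _    = ≤-refl
    ... | yes 0≤x = proj₁ (proj₂ (supremum _ _ _)) 0# (≤-respˡ-≈ (sym (zeroˡ 0#)) 0≤x)

    -- If σ² ≠ x, then the mean (x + σ²)/2σ (for σ² > x) or the point
    -- σ + e/(2σ + 1 + e) with e = x − σ² > 0 lies strictly between σ and √ x.
    square-of-supremum : ∀ {x σ} → 0# ≤ x → 0# ≤ σ → IsSupremum (λ y → y * y ≤ x) σ → σ * σ ≈ x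
    square-of-supremum {x} {σ} 0≤x 0≤σ (σ-upper , σ-approx) = antisym σ²≤x x≤σ²
      where
      σ²≤x : σ * σ ≤ x
      σ²≤x with σ * σ ≤? x
      ... | yes p = p
      ... | no ¬p = ⊥-elim (let z , z²≤x , ξ<z = σ-approx ξ ξ<σ in
        <⇒≱ ξ<z (square-mono⁻¹ 0≤ξ (≤-trans z²≤x x≤ξ²)))
        where
        x<σ² : x < σ * σ
        x<σ² = ≰⇒> ¬p
        0<σ : 0# < σ
        0<σ = 0≤σ , λ e → <⇒≱ x<σ²
          (≤-respˡ-≈ (trans (sym (zeroˡ 0#)) (*-cong e e)) 0≤x)
        ξ i : Carrier
        i = (σ + σ) ⁻¹
        ξ = (x + σ * σ) * i
        ξ*2σ : ξ * (σ + σ) ≈ x + σ * σ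
        ξ*2σ = ÷-cancel (x + σ * σ) (+-pos 0<σ 0≤σ)
        0≤i : 0# ≤ i
        0≤i = <⇒≤ (⁻¹-pos (+-pos 0<σ 0≤σ))
        0≤ξ : 0# ≤ ξ
        0≤ξ = *-nonneg (+-nonneg 0≤x (square-nonneg σ)) 0≤i
        ξ<σ : ξ < σ
        ξ<σ = by-< (*-pos (x<y⇒0<y-x x<σ²) (⁻¹-pos (+-pos 0<σ 0≤σ)))
          (trans (+-congʳ (sym (÷-cancel σ (+-pos 0<σ 0≤σ))))
            (solve 3 (λ x σ i → σ :* i :* (σ :+ σ) :- (x :+ σ :* σ) :* i
              := (σ :* σ :- x) :* i) refl x σ i))
        x≤ξ² : x ≤ ξ * ξ
        -- A Newton step never falls below the root: since ξ · 2σ = x + σ², one has ξ² - x = (ξ -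
        -- σ)².
        x≤ξ² = by-≤ (square-nonneg (ξ - σ))
          (trans (solve 3 (λ x σ ξ → ξ :* ξ :- x := (ξ :- σ) :* (ξ :- σ)
              :+ (ξ :* (σ :+ σ) :- (x :+ σ :* σ))) refl x σ ξ)
            (trans (+-congˡ (trans (+-congʳ ξ*2σ) (-‿inverseʳ _))) (+-identityʳ _)))
      x≤σ² : x ≤ σ * σ
      x≤σ² with x ≤? σ * σ
      ... | yes p = p
      ... | no ¬p = ⊥-elim (<⇒≱ σ<ξ (σ-upper ξ ξ²≤x))
        where
        e D h ξ : Carrier
        e = x - σ * σ
        -- With e = h D, the gap x - (σ + h)² equals h (1 + e - h): the summand 1 + e forces h ≤ 1
        -- and then absorbs h².
        D = σ + σ + 1# + e
        h = e ÷ D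
        ξ = σ + h
        0<e : 0# < e
        0<e = x<y⇒0<y-x (≰⇒> ¬p)
        0<D : 0# < D
        0<D = +-posʳ (+-nonneg (+-nonneg 0≤σ 0≤σ) 0≤1) 0<e
        0<h : 0# < h
        0<h = ÷-pos 0<e 0<D
        h*D : h * D ≈ e
        h*D = ÷-cancel e 0<D
        σ<ξ : σ < ξ
        σ<ξ = by-< 0<h (solve 2 (λ σ h → σ :+ h :- σ := h) refl σ h)
        -- h D = e bounds h by 1, since D ≥ 1 + e.
        h≤1 : h ≤ 1#
        h≤1 = 0≤y-x⇒x≤y (*-cancelˡ-≤0 0<D (≤-respʳ-≈
          (trans (solve 2 (λ σ e → σ :+ σ :+ :1 := (σ :+ σ :+ :1 :+ e) :- e) refl σ e)
            (trans (+-congˡ (-‿cong (sym h*D)))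
              (solve 2 (λ D h → D :- h :* D := D :* (:1 :- h)) refl D h)))
          (+-nonneg (+-nonneg 0≤σ 0≤σ) 0≤1)))
        ξ²≤x : ξ * ξ ≤ x
        ξ²≤x = by-≤ (*-nonneg (<⇒≤ 0<h) (+-nonneg (x≤y⇒0≤y-x h≤1) (<⇒≤ 0<e)))
          (trans (solve 3 (λ x σ h → x :- (σ :+ h) :* (σ :+ h)
              := (x :- σ :* σ) :- h :* (σ :+ σ) :- h :* h) refl x σ h)
            (trans (+-congʳ (+-congʳ (sym h*D)))
              (solve 3 (λ e σ h → h :* (σ :+ σ :+ :1 :+ e) :- h :* (σ :+ σ) :- h :* h
                := h :* ((:1 :- h) :+ e)) refl e σ h)))

    √-square : ∀ {x} → 0# ≤ x → √ x * √ x ≈ x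
    -- Abstracting `√-nonneg x` together with the test lets its type mention the supremum to which
    -- `√ x` reduces.
    √-square {x} p with 0# ≤? x | √-nonneg x
    ... | no ¬p   | _   = ⊥-elim (¬p p)
    ... | yes 0≤x | 0≤σ = square-of-supremum 0≤x 0≤σ (proj₂ (supremum _ _ _))

  -- Read off the supremum of {0} ∪ {1 ∣ P}.
  excludedMiddle : (P : Set) → P ⊎ ¬ P
  excludedMiddle P = decide (supremum S (0# , inj₁ refl) (1# , upper-1))
    where
    S : Carrier → Set
    S x = x ≈ 0# ⊎ (x ≈ 1# × P)
    upper-1 : UpperBound S 1#
    upper-1 x (inj₁ e)       = ≤-respˡ-≈ (sym e) 0≤1
    upper-1 x (inj₂ (e , _)) = ≤-reflexive e
    decide : ∃ (IsSupremum S) → P ⊎ ¬ P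
    decide (σ , upper , approx) with σ ≤? 0#
    ... | yes σ≤0 = inj₂ λ p → <⇒≱ 0<1 (≤-trans (upper 1# (inj₂ (refl , p))) σ≤0)
    ... | no σ≰0 with approx 0# (≰⇒> σ≰0)
    ... | x , inj₁ e       , 0<x = ⊥-elim (pos⇒≉0 0<x e)
    ... | x , inj₂ (_ , p) , _   = inj₁ p

  abstract
    halve : ∀ {x} → 0# < x → ∃[ h ] 0# < h × h + h ≈ x
    halve {x} p = x ÷ (1# + 1#) , ÷-pos p 0<2 ,
      trans (solve 1 (λ h → h :+ h := h :* (:1 :+ :1)) refl (x ÷ (1# + 1#))) (÷-cancel x 0<2)

    minPos : ∀ {x y} → 0# < x → 0# < y → ∃[ m ] 0# < m × m ≤ x × m ≤ y
    minPos {x} {y} p q with total x y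
    ... | inj₁ r = x , p , ≤-refl , r
    ... | inj₂ r = y , q , r , ≤-refl

    -- Cousin's lemma, the form in which compactness is used. Let σ be the supremum of the points x
    -- with `Q a x`, and h half of the δ at σ. Some such x lies above σ - h, and one local step
    -- leads from it to any y in [σ , σ + h] up to b. Either this reaches b, or σ + h itself
    -- qualifies and contradicts the choice of σ.
    cousin : ∀ {a b} → a ≤ b → (Q : Carrier → Carrier → Set) →
      (∀ {x y z} → x ≤ y → y ≤ z → Q x y → Q y z → Q x z) →
      (∀ x → a ≤ x → x ≤ b → ∃[ δ ] 0# < δ ×
        (∀ s t → a ≤ s → s ≤ x → x ≤ t → t ≤ b → t - s < δ → Q s t)) →
      Q a b
    cousin {a} {b} a≤b Q join local = reach (supremum S (a , a∈S) (b , λ _ p → proj₁ (proj₂ p)))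
      where
      S : Carrier → Set
      S x = a ≤ x × x ≤ b × Q a x
      a∈S : S a
      a∈S with local a ≤-refl a≤b
      ... | δ , 0<δ , Qδ = ≤-refl , a≤b , Qδ a a ≤-refl ≤-refl ≤-refl a≤b
        (<-respˡ-≈ (sym (-‿inverseʳ a)) 0<δ)
      reach : ∃ (IsSupremum S) → Q a b
      reach (σ , upper , approx) = fromLocal (local σ (upper a a∈S) σ≤b)
        where
        σ≤b : σ ≤ b
        σ≤b with σ ≤? b
        ... | yes p = p
        ... | no ¬p with approx b (≰⇒> ¬p)
        ... | x , (_ , x≤b , _) , b<x = ⊥-elim (<⇒≱ b<x x≤b)
        fromLocal : (∃[ δ ] 0# < δ ×
          (∀ s t → a ≤ s → s ≤ σ → σ ≤ t → t ≤ b → t - s < δ → Q s t)) → Q a b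
        fromLocal (δ , 0<δ , Qδ) = fromBelow (halve 0<δ)
          where
          fromBelow : (∃[ h ] 0# < h × h + h ≈ δ) → Q a b
          fromBelow (h , 0<h , h+h≈δ) = fromPoint (approx (σ - h) σ-h<σ)
            where
            σ-h<σ : σ - h < σ
            σ-h<σ = by-< 0<h (solve 2 (λ σ h → σ :- (σ :- h) := h) refl σ h)
            fromPoint : (∃[ x ] S x × σ - h < x) → Q a b
            fromPoint (x , x∈S@(a≤x , x≤b , Qax) , σ-h<x) = extend (total b (σ + h))
              where
              x≤σ : x ≤ σ
              x≤σ = upper x x∈S
              advance : ∀ y → σ ≤ y → y ≤ b → y ≤ σ + h → Q a y
              advance y σ≤y y≤b y≤σ+h = join a≤x (≤-trans x≤σ σ≤y) Qax
                (Qδ x y a≤x x≤σ σ≤y y≤b (by-<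
                  (+-pos (x<y⇒0<y-x σ-h<x) (x≤y⇒0≤y-x y≤σ+h))
                  (trans (+-congʳ (sym h+h≈δ))
                    (solve 4 (λ h x y σ → h :+ h :- (y :- x) := x :- (σ :- h) :+ (σ :+ h :- y))
                      refl h x y σ))))
              extend : b ≤ σ + h ⊎ σ + h ≤ b → Q a b
              extend (inj₁ p) = advance b σ≤b ≤-refl p
              extend (inj₂ p) = ⊥-elim (<⇒≱ σ<y (upper (σ + h) (≤-trans (upper a a∈S) (<⇒≤ σ<y) , p ,
                advance (σ + h) (<⇒≤ σ<y) p ≤-refl)))
                where
                σ<y : σ < σ + h
                σ<y = by-< (0<h) (solve 2 (λ σ h → σ :+ h :- σ := h) refl σ h)

-- Uniform limits, continuity and derivatives on an interval.

module Differentiation (ℝ : Reals) where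
  open Reals ℝ hiding (zero)
  open Analysis ℝ
  open RingSolver commutativeRing
  open OrderedField ℝ
  open Completeness ℝ

  module _ {u v : Carrier} where

    -- A tagged subinterval of [u , v]. All limits are taken as its mesh tends to 0, uniformly in
    -- its position, so that continuity, difference quotients and Riemann sums share one calculus.
    record Triple : Set where
      constructor triple
      field
        {left mid right} : Carrier
        u≤left    : u ≤ left
        left≤mid  : left ≤ mid
        mid≤right : mid ≤ right
        right≤v   : right ≤ v

      mesh : Carrier
      mesh = right - left

    open Triple public

    u≤mid : ∀ τ → u ≤ mid τ
    u≤mid τ = ≤-trans (u≤left τ) (left≤mid τ)

    mid≤v : ∀ τ → mid τ ≤ v
    mid≤v τ = ≤-trans (mid≤right τ) (right≤v τ)

    u≤right : ∀ τ → u ≤ right τ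
    u≤right τ = ≤-trans (u≤mid τ) (mid≤right τ)

    left≤v : ∀ τ → left τ ≤ v
    left≤v τ = ≤-trans (left≤mid τ) (mid≤v τ)

    mesh-nonneg : ∀ τ → 0# ≤ mesh τ
    mesh-nonneg τ = x≤y⇒0≤y-x (≤-trans (left≤mid τ) (mid≤right τ))

    Bounded : (Triple → Carrier) → Set
    Bounded A = ∃[ M ] 0# < M × (∀ τ → ∣ A τ ∣≤ M)

    Null : (Triple → Carrier) → Set
    Null A = ∀ ε → 0# < ε → ∃[ δ ] 0# < δ × (∀ τ → mesh τ < δ → ∣ A τ ∣≤ ε)

    Bounded-resp : ∀ {A B} → (∀ τ → A τ ≈ B τ) → Bounded A → Bounded B
    Bounded-resp e (M , p , b) = M , p , λ τ → abs-resp (e τ) refl (b τ)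

    Bounded-+ : ∀ {A B} → Bounded A → Bounded B → Bounded (λ τ → A τ + B τ)
    Bounded-+ (M , p , a) (N , q , b) = M + N , +-pos p (<⇒≤ q) , λ τ → abs-+ (a τ) (b τ)

    Bounded-* : ∀ {A B} → Bounded A → Bounded B → Bounded (λ τ → A τ * B τ)
    Bounded-* (M , p , a) (N , q , b) = M * N , *-pos p q , λ τ → abs-* (a τ) (b τ)

    Bounded-const : ∀ c → Bounded (λ _ → c)
    Bounded-const c with total 0# c
    ... | inj₁ p = c + 1# , +-posʳ p 0<1 , λ _ → mk
      (by-≤ 0≤1 (solve 1 (λ c → c :+ :1 :- c := :1) refl c))
      (by-≤ (+-nonneg 0≤1 (+-nonneg p p)) (solve 1 (λ c → c :+ :1 :- :- c := :1 :+ (c :+ c)) refl c))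
    ... | inj₂ p = - c + 1# , +-posʳ 0≤-c 0<1 , λ _ → mk
      (by-≤ (+-nonneg 0≤1 (+-nonneg 0≤-c 0≤-c)) (solve 1 (λ c → :- c :+ :1 :- c := :1 :+ (:- c :- c)) refl c))
      (by-≤ 0≤1 (solve 1 (λ c → :- c :+ :1 :- :- c := :1) refl c))
      where
      0≤-c : 0# ≤ - c
      0≤-c = ≤-respʳ-≈ (+-identityˡ _) (x≤y⇒0≤y-x p)

    Null-resp : ∀ {A B} → (∀ τ → A τ ≈ B τ) → Null A → Null B
    Null-resp e a ε 0<ε with a ε 0<ε
    ... | δ , 0<δ , aδ = δ , 0<δ , λ τ m → abs-resp (e τ) refl (aδ τ m)

    Null-0 : Null (λ _ → 0#)
    Null-0 ε 0<ε = 1# , 0<1 , λ _ _ → abs-0 (<⇒≤ 0<ε)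

    Null-+ : ∀ {A B} → Null A → Null B → Null (λ τ → A τ + B τ)
    Null-+ a b ε 0<ε with halve 0<ε
    ... | h , 0<h , h+h≈ε with a h 0<h | b h 0<h
    ... | δ₁ , p , aδ | δ₂ , q , bδ with minPos p q
    ... | δ , 0<δ , δ≤δ₁ , δ≤δ₂ = δ , 0<δ , λ τ m →
      abs-resp refl h+h≈ε (abs-+ (aδ τ (<-≤-trans m δ≤δ₁)) (bδ τ (<-≤-trans m δ≤δ₂)))

    Null-* : ∀ {A B} → Bounded A → Null B → Null (λ τ → A τ * B τ)
    Null-* (M , 0<M , a) b ε 0<ε with b (ε ÷ M) (÷-pos 0<ε 0<M)
    ... | δ , 0<δ , bδ = δ , 0<δ , λ τ m →
      abs-resp refl (trans (*-comm M _) (÷-cancel ε 0<M)) (abs-* (a τ) (bδ τ m))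

    -- If a² - b² ≤ ε², then a² ≤ b² + ε² ≤ (b + ε)². This makes the square root uniformly
    -- continuous down to 0, where it is not Lipschitz.
    Null-of-squares : ∀ {A B : Triple → Carrier} → (∀ τ → 0# ≤ A τ) → (∀ τ → 0# ≤ B τ) →
      Null (λ τ → A τ * A τ - B τ * B τ) → Null (λ τ → A τ - B τ)
    Null-of-squares {A} {B} 0≤A 0≤B n ε 0<ε with n (ε * ε) (*-pos 0<ε 0<ε)
    ... | δ , 0<δ , nδ = δ , 0<δ , λ τ m → mk
      (bound (0≤A τ) (0≤B τ) (upper (nδ τ m)))
      (≤-respˡ-≈ (solve 2 (λ a b → b :- a := :- (a :- b)) refl (A τ) (B τ)) (bound (0≤B τ) (0≤A τ)
        (≤-respˡ-≈ (solve 2 (λ a b → :- (a :* a :- b :* b) := b :* b :- a :* a) refl (A τ) (B τ))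
          (lower (nδ τ m)))))
      where
      bound : ∀ {a b} → 0# ≤ a → 0# ≤ b → a * a - b * b ≤ ε * ε → a - b ≤ ε
      bound {a} {b} 0≤a 0≤b p = by-≤ (x≤y⇒0≤y-x a≤b+ε)
        (solve 3 (λ a b e → e :- (a :- b) := b :+ e :- a) refl a b ε)
        where
        a≤b+ε : a ≤ b + ε
        a≤b+ε = square-mono⁻¹ (+-nonneg 0≤b (<⇒≤ 0<ε)) (by-≤
          (+-nonneg (x≤y⇒0≤y-x p) (*-nonneg 0≤b (+-nonneg (<⇒≤ 0<ε) (<⇒≤ 0<ε))))
          (solve 3 (λ a b e → (b :+ e) :* (b :+ e) :- a :* a
            := (e :* e :- (a :* a :- b :* b)) :+ b :* (e :+ e)) refl a b ε))

    infix 4 _~_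
    -- Boundedness is carried along because products need it: a b - a′ b′ = b (a - a′) + a′ (b -
    -- b′). It is thus never deduced from compactness.
    record _~_ (A B : Triple → Carrier) : Set where
      constructor asymptotic
      field
        boundedˡ : Bounded A
        boundedʳ : Bounded B
        null     : Null (λ τ → A τ - B τ)
    open _~_ public

    ~-refl : ∀ {A} → Bounded A → A ~ A
    ~-refl {A} b = asymptotic b b (Null-resp (λ τ → sym (-‿inverseʳ (A τ))) Null-0)

    ~-resp : ∀ {A A′ B B′} → (∀ τ → A τ ≈ A′ τ) → (∀ τ → B τ ≈ B′ τ) → A ~ B → A′ ~ B′
    ~-resp p q (asymptotic a b n) = asymptotic (Bounded-resp p a) (Bounded-resp q b)
      (Null-resp (λ τ → +-cong (p τ) (-‿cong (q τ))) n)

    ~-+ : ∀ {A A′ B B′} → A ~ A′ → B ~ B′ → (λ τ → A τ + B τ) ~ (λ τ → A′ τ + B′ τ)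
    ~-+ {A} {A′} {B} {B′} (asymptotic a a′ m) (asymptotic b b′ n) =
      asymptotic (Bounded-+ a b) (Bounded-+ a′ b′) (Null-resp
        (λ τ → solve 4 (λ a a′ b b′ → (a :- a′) :+ (b :- b′) := a :+ b :- (a′ :+ b′))
          refl (A τ) (A′ τ) (B τ) (B′ τ)) (Null-+ m n))

    ~-* : ∀ {A A′ B B′} → A ~ A′ → B ~ B′ → (λ τ → A τ * B τ) ~ (λ τ → A′ τ * B′ τ)
    ~-* {A} {A′} {B} {B′} (asymptotic a a′ m) (asymptotic b b′ n) =
      asymptotic (Bounded-* a b) (Bounded-* a′ b′) (Null-resp
        (λ τ → solve 4 (λ a a′ b b′ → b :* (a :- a′) :+ a′ :* (b :- b′) := a :* b :- a′ :* b′)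
          refl (A τ) (A′ τ) (B τ) (B′ τ)) (Null-+ (Null-* b m) (Null-* a′ n)))

    ~-+null : ∀ {A B N} → A ~ B → Bounded N → Null N → (λ τ → A τ + N τ) ~ B
    ~-+null {A} {B} {N} (asymptotic a b m) bd n = asymptotic (Bounded-+ a bd) b (Null-resp
      (λ τ → solve 3 (λ a b n → (a :- b) :+ n := a :+ n :- b) refl (A τ) (B τ) (N τ)) (Null-+ m n))

    ~-⁻¹ : ∀ {A B m} → 0# < m → (∀ τ → m ≤ A τ) → (∀ τ → m ≤ B τ) →
      A ~ B → (λ τ → A τ ⁻¹) ~ (λ τ → B τ ⁻¹)
    ~-⁻¹ {A} {B} {m} 0<m m≤A m≤B (asymptotic a b n) = asymptotic bdA bdB
      (Null-resp difference (Null-* (Bounded-* bdA bdB)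
        (Null-resp (λ τ → solve 2 (λ a b → (:0 :- :1) :* (a :- b) := b :- a) refl (A τ) (B τ))
          (Null-* (Bounded-const (0# - 1#)) n))))
      where
      bound : ∀ {x} → m ≤ x → ∣ x ⁻¹ ∣≤ m ⁻¹
      bound {x} m≤x = mk (x⁻¹≤m⁻¹) (by-≤ (+-nonneg (<⇒≤ (⁻¹-pos 0<m)) (<⇒≤ (⁻¹-pos 0<x)))
          (solve 2 (λ m x → m :- :- x := m :+ x) refl (m ⁻¹) (x ⁻¹)))
        where
        0<x : 0# < x
        0<x = <-≤-trans 0<m m≤x
        x⁻¹≤m⁻¹ : x ⁻¹ ≤ m ⁻¹
        x⁻¹≤m⁻¹ = by-≤ (*-nonneg (x≤y⇒0≤y-x m≤x) (<⇒≤ (*-pos (⁻¹-pos 0<m) (⁻¹-pos 0<x))))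
          (trans (+-cong (trans (sym (*-identityʳ _)) (*-congˡ (sym (⁻¹-inverseʳ (pos⇒≉0 0<x)))))
                   (-‿cong (trans (sym (*-identityʳ _)) (*-congˡ (sym (⁻¹-inverseʳ (pos⇒≉0 0<m)))))))
            (solve 4 (λ m x i j → i :* (x :* j) :- j :* (m :* i) := (x :- m) :* (i :* j))
              refl m x (m ⁻¹) (x ⁻¹)))
      bdA : Bounded (λ τ → A τ ⁻¹)
      bdA = m ⁻¹ , ⁻¹-pos 0<m , λ τ → bound (m≤A τ)
      bdB : Bounded (λ τ → B τ ⁻¹)
      bdB = m ⁻¹ , ⁻¹-pos 0<m , λ τ → bound (m≤B τ)
      inverses : ∀ a b → 0# < a → 0# < b → a ⁻¹ * b ⁻¹ * (b - a) ≈ a ⁻¹ - b ⁻¹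
      inverses a b 0<a 0<b = trans
        (solve 4 (λ a b i j → i :* j :* (b :- a) := i :* (b :* j) :- j :* (a :* i)) refl a b (a ⁻¹) (b ⁻¹))
        (+-cong (trans (*-congˡ (⁻¹-inverseʳ (pos⇒≉0 0<b))) (*-identityʳ _))
          (-‿cong (trans (*-congˡ (⁻¹-inverseʳ (pos⇒≉0 0<a))) (*-identityʳ _))))
      difference : ∀ τ → A τ ⁻¹ * B τ ⁻¹ * (B τ - A τ) ≈ A τ ⁻¹ - B τ ⁻¹
      difference τ = inverses (A τ) (B τ) (<-≤-trans 0<m (m≤A τ)) (<-≤-trans 0<m (m≤B τ))

  private
    variable
      u v : Carrier

  EqualOn : Carrier → Carrier → (f g : Carrier → Carrier) → Set
  EqualOn u v f g = ∀ x → u ≤ x → x ≤ v → f x ≈ g x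

  -- Bounded uniform continuity. Both ends are compared with the tag because the difference quotient
  -- of a product is evaluated at the ends, its limit at the tag.
  record Continuous (u v : Carrier) (f : Carrier → Carrier) : Set where
    constructor continuous
    field
      atLeft  : (λ (τ : Triple {u} {v}) → f (left τ)) ~ (λ τ → f (mid τ))
      atRight : (λ (τ : Triple {u} {v}) → f (right τ)) ~ (λ τ → f (mid τ))
  open Continuous public

  -- Φ′ = f uniformly, with f taken at an arbitrary point between the ends of the
  -- difference quotient, so that Riemann sums of f telescope up to a small error.
  record Derivative (u v : Carrier) (Φ f : Carrier → Carrier) : Set where
    constructor derivative
    field
      cont     : Continuous u v Φ
      slope    : Triple {u} {v} → Carrier
      quotient : ∀ τ → Φ (right τ) - Φ (left τ) ≈ slope τ * mesh τ
      limit    : slope ~ (λ τ → f (mid τ))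
  open Derivative public

  Continuous-cong : ∀ {f g} → EqualOn u v f g → Continuous u v f → Continuous u v g
  Continuous-cong e (continuous l r) = continuous
    (~-resp (λ τ → e _ (u≤left τ) (left≤v τ)) (λ τ → e _ (u≤mid τ) (mid≤v τ)) l)
    (~-resp (λ τ → e _ (u≤right τ) (right≤v τ)) (λ τ → e _ (u≤mid τ) (mid≤v τ)) r)

  Derivative-cong : ∀ {Φ Ψ f g} → EqualOn u v Φ Ψ → EqualOn u v f g →
    Derivative u v Φ f → Derivative u v Ψ g
  Derivative-cong p q (derivative c s eq l) = derivative (Continuous-cong p c) s
    (λ τ → trans (sym (+-cong (p _ (u≤right τ) (right≤v τ))
                              (-‿cong (p _ (u≤left τ) (left≤v τ))))) (eq τ))
    (~-resp (λ _ → refl) (λ τ → q _ (u≤mid τ) (mid≤v τ)) l)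

  Continuous-const : ∀ c → Continuous u v (λ _ → c)
  Continuous-const c = continuous (~-refl (Bounded-const c)) (~-refl (Bounded-const c))

  Continuous-+ : ∀ {f g} → Continuous u v f → Continuous u v g → Continuous u v (λ x → f x + g x)
  Continuous-+ (continuous l r) (continuous l′ r′) = continuous (~-+ l l′) (~-+ r r′)

  Continuous-* : ∀ {f g} → Continuous u v f → Continuous u v g → Continuous u v (λ x → f x * g x)
  Continuous-* (continuous l r) (continuous l′ r′) = continuous (~-* l l′) (~-* r r′)

  Continuous-id : Continuous u v (λ x → x)
  Continuous-id {u} {v} = continuous
    (asymptotic (bd (λ τ → u≤left τ , left≤v τ)) (bd (λ τ → u≤mid τ , mid≤v τ))
      λ ε 0<ε → ε , 0<ε , λ τ m → abs-swap (nonneg-abs (left≤mid τ)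
        (≤-trans (+-monoˡ _ (mid≤right τ)) (<⇒≤ m))))
    (asymptotic (bd (λ τ → u≤right τ , right≤v τ)) (bd (λ τ → u≤mid τ , mid≤v τ))
      λ ε 0<ε → ε , 0<ε , λ τ m → nonneg-abs (mid≤right τ)
        (≤-trans (by-≤ (x≤y⇒0≤y-x (left≤mid τ))
          (solve 3 (λ x t y → y :- x :- (y :- t) := t :- x) refl _ _ _)) (<⇒≤ m)))
    where
    nonneg-abs : ∀ {x y ε} → x ≤ y → y - x ≤ ε → ∣ y - x ∣≤ ε
    nonneg-abs {x} {y} p q = mk q (≤-trans (by-≤ (+-nonneg (x≤y⇒0≤y-x p) (x≤y⇒0≤y-x p))
      (solve 2 (λ x y → y :- x :- :- (y :- x) := (y :- x) :+ (y :- x)) refl x y)) q)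
    bd : {A : Triple {u} {v} → Carrier} → (∀ τ → u ≤ A τ × A τ ≤ v) → Bounded A
    bd {A} p with Bounded-const {u} {v} u | Bounded-const {u} {v} v
    ... | M , 0<M , a | N , 0<N , b = M + N , +-pos 0<M (<⇒≤ 0<N) , λ τ → mk
      (≤-trans (proj₂ (p τ)) (by-≤ (+-nonneg (<⇒≤ 0<M) (x≤y⇒0≤y-x (upper (b τ))))
        (solve 3 (λ m n v → m :+ n :- v := m :+ (n :- v)) refl _ _ _)))
      (by-≤ (+-nonneg (+-nonneg (x≤y⇒0≤y-x (proj₁ (p τ))) (x≤y⇒0≤y-x (lower (a τ)))) (<⇒≤ 0<N))
        (solve 4 (λ m n u x → m :+ n :- :- x := (x :- u) :+ (m :- :- u) :+ n) refl _ _ _ _))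

  Derivative-const : ∀ c → Derivative u v (λ _ → c) (λ _ → 0#)
  Derivative-const c = derivative (Continuous-const c) (λ _ → 0#)
    (λ τ → trans (-‿inverseʳ c) (sym (zeroˡ _))) (~-refl (Bounded-const 0#))

  Derivative-id : Derivative u v (λ x → x) (λ _ → 1#)
  Derivative-id = derivative Continuous-id (λ _ → 1#)
    (λ τ → sym (*-identityˡ _)) (~-refl (Bounded-const 1#))

  Derivative-+ : ∀ {Φ Ψ f g} → Derivative u v Φ f → Derivative u v Ψ g →
    Derivative u v (λ x → Φ x + Ψ x) (λ x → f x + g x)
  Derivative-+ {Φ = Φ} {Ψ} (derivative c s eq l) (derivative c′ s′ eq′ l′) =
    derivative (Continuous-+ c c′) (λ τ → s τ + s′ τ)
      (λ τ → trans (solve 4 (λ a b c d → a :+ b :- (c :+ d) := a :- c :+ (b :- d)) refl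
                      (Φ (right τ)) (Ψ (right τ)) (Φ (left τ)) (Ψ (left τ)))
               (trans (+-cong (eq τ) (eq′ τ)) (sym (distribʳ _ _ _))))
      (~-+ l l′)

  Derivative-* : ∀ {Φ Ψ f g} → Derivative u v Φ f → Derivative u v Ψ g →
    Derivative u v (λ x → Φ x * Ψ x) (λ x → f x * Ψ x + Φ x * g x)
  Derivative-* {Φ = Φ} {Ψ} (derivative c s eq l) (derivative c′ s′ eq′ l′) =
    -- The increment of the product is split with one factor at the right end and the other at the
    -- left; the continuity stored in the derivatives moves both to the tag.
    derivative (Continuous-* c c′) (λ τ → s τ * Ψ (right τ) + Φ (left τ) * s′ τ)
      (λ τ → trans (solve 4 (λ a b c d → a :* b :- c :* d := (a :- c) :* b :+ c :* (b :- d)) refl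
                      (Φ (right τ)) (Ψ (right τ)) (Φ (left τ)) (Ψ (left τ)))
               (trans (+-cong (*-congʳ (eq τ)) (*-congˡ (eq′ τ)))
                 (solve 5 (λ s s′ m b c → s :* m :* b :+ c :* (s′ :* m) := (s :* b :+ c :* s′) :* m)
                   refl (s τ) (s′ τ) (mesh τ) (Ψ (right τ)) (Φ (left τ)))))
      (~-+ (~-* l (atRight c′)) (~-* (atLeft c) l′))

  Derivative-scale : ∀ c {Φ f} → Derivative u v Φ f → Derivative u v (λ x → c * Φ x) (λ x → c * f x)
  Derivative-scale c {Φ} {f} D = Derivative-cong (λ _ _ _ → refl)
    (λ x _ _ → trans (+-congʳ (zeroˡ (Φ x))) (+-identityˡ _)) (Derivative-* (Derivative-const c) D)

  eval-⊞ : ∀ p q x → eval (p ⊞ q) x ≈ eval p x + eval q x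
  eval-⊞ []      q       x = sym (+-identityˡ _)
  eval-⊞ (a ∷ p) []      x = sym (+-identityʳ _)
  eval-⊞ (a ∷ p) (b ∷ q) x = trans (+-congˡ (*-congˡ (eval-⊞ p q x)))
    (solve 5 (λ a b x p q → a :+ b :+ x :* (p :+ q) := a :+ x :* p :+ (b :+ x :* q)) refl
      a b x (eval p x) (eval q x))

  eval-deriv : ∀ a p x → eval (deriv (a ∷ p)) x ≈ 0# + (1# * eval p x + x * eval (deriv p) x)
  eval-deriv a p x = trans (eval-⊞ p (0# ∷ deriv p) x)
    (solve 3 (λ x p p′ → p :+ (:0 :+ x :* p′) := :0 :+ (:1 :* p :+ x :* p′)) refl
      x (eval p x) (eval (deriv p) x))

  Derivative-eval : ∀ p → Derivative u v (eval p) (eval (deriv p))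
  Derivative-eval []      = Derivative-const 0#
  Derivative-eval (a ∷ p) = Derivative-cong (λ _ _ _ → refl) (λ x _ _ → sym (eval-deriv a p x))
    (Derivative-+ (Derivative-const a) (Derivative-* Derivative-id (Derivative-eval p)))

-- Derivatives of square roots, Riemann sums, the fundamental theorem.

module Integration (ℝ : Reals) where
  open Reals ℝ hiding (zero)
  open Analysis ℝ
  open RingSolver commutativeRing
  open OrderedField ℝ
  open Completeness ℝ
  open Differentiation ℝ

  private
    variable
      u v : Carrier

  NonnegOn : Carrier → Carrier → (Carrier → Carrier) → Set
  NonnegOn u v p = ∀ x → u ≤ x → x ≤ v → 0# ≤ p x

  abstract
    ~-√ : {A B : Triple {u} {v} → Carrier} → (∀ τ → 0# ≤ A τ) → (∀ τ → 0# ≤ B τ) →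
      A ~ B → (λ τ → √ A τ) ~ (λ τ → √ B τ)
    ~-√ {u} {v} 0≤A 0≤B (asymptotic a b n) = asymptotic (bd 0≤A a) (bd 0≤B b)
      (Null-of-squares (λ τ → √-nonneg _) (λ τ → √-nonneg _)
        (Null-resp (λ τ → +-cong (sym (√-square (0≤A τ))) (-‿cong (sym (√-square (0≤B τ))))) n))
      where
      bd : {A : Triple {u} {v} → Carrier} → (∀ τ → 0# ≤ A τ) → Bounded A → Bounded (λ τ → √ A τ)
      bd {A} 0≤A (M , 0<M , a) = M + 1# , +-pos 0<M 0≤1 , λ τ →
        mk (√A≤M+1 τ) (≤-trans (by-≤ (+-nonneg (√-nonneg (A τ)) (√-nonneg (A τ)))
          (solve 1 (λ x → x :- :- x := x :+ x) refl (√ A τ))) (√A≤M+1 τ))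
        where
        √A≤M+1 : ∀ τ → √ A τ ≤ M + 1#
        √A≤M+1 τ = square-mono⁻¹ (+-nonneg (<⇒≤ 0<M) 0≤1)
          (≤-respˡ-≈ (sym (√-square (0≤A τ))) (by-≤
            (+-nonneg (+-nonneg (+-nonneg (square-nonneg M) (<⇒≤ 0<M)) 0≤1) (x≤y⇒0≤y-x (upper (a τ))))
            (solve 2 (λ m x → (m :+ :1) :* (m :+ :1) :- x := m :* m :+ m :+ :1 :+ (m :- x))
              refl M (A τ))))

    Continuous-√ : ∀ {p} → NonnegOn u v p → Continuous u v p → Continuous u v (λ x → √ p x)
    Continuous-√ 0≤p (continuous l r) = continuous
      (~-√ (λ τ → 0≤p _ (u≤left τ) (left≤v τ)) (λ τ → 0≤p _ (u≤mid τ) (mid≤v τ)) l)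
      (~-√ (λ τ → 0≤p _ (u≤right τ) (right≤v τ)) (λ τ → 0≤p _ (u≤mid τ) (mid≤v τ)) r)

    -- The quotient is that of p divided by √ p (right) + √ p (left). The bound m keeps this divisor
    -- away from 0, as a uniform limit demands.
    Derivative-√ : ∀ {p p′ m} → NonnegOn u v p → 0# < m → (∀ x → u ≤ x → x ≤ v → m ≤ √ p x) →
      Derivative u v p p′ → Derivative u v (λ x → √ p x) (λ x → p′ x * (√ p x + √ p x) ⁻¹)
    Derivative-√ {u} {v} {p} {p′} {m} 0≤p 0<m m≤w (derivative c s eq l) = derivative cw
      (λ τ → s τ * (√ p (right τ) + √ p (left τ)) ⁻¹)
      (λ τ → quot (√-square (0≤p _ (u≤right τ) (right≤v τ))) (√-square (0≤p _ (u≤left τ) (left≤v τ)))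
        (<-≤-trans 0<m+m (+-mono-≤ (m≤w _ (u≤right τ) (right≤v τ)) (m≤w _ (u≤left τ) (left≤v τ))))
        (eq τ))
      (~-* l (~-⁻¹ 0<m+m
        (λ τ → +-mono-≤ (m≤w _ (u≤right τ) (right≤v τ)) (m≤w _ (u≤left τ) (left≤v τ)))
        (λ τ → +-mono-≤ (m≤w _ (u≤mid τ) (mid≤v τ)) (m≤w _ (u≤mid τ) (mid≤v τ)))
        (~-+ (atRight cw) (atLeft cw))))
      where
      cw : Continuous u v (λ x → √ p x)
      cw = Continuous-√ 0≤p c
      0<m+m : 0# < m + m
      0<m+m = +-pos 0<m (<⇒≤ 0<m)
      quot : ∀ {X Y px py s h} → Y * Y ≈ py → X * X ≈ px → 0# < Y + X → py - px ≈ s * h →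
        Y - X ≈ s * (Y + X) ⁻¹ * h
      quot {X} {Y} {px} {py} {s} {h} Y² X² 0<Y+X e = *-cancelˡ (pos⇒≉0 0<Y+X)
        (trans (solve 2 (λ x y → (y :+ x) :* (y :- x) := y :* y :- x :* x) refl X Y)
        (trans (+-cong Y² (-‿cong X²)) (trans e
        (trans (trans (sym (*-identityˡ _)) (*-congʳ (sym (⁻¹-inverseʳ (pos⇒≉0 0<Y+X)))))
          (solve 4 (λ z i s h → z :* i :* (s :* h) := z :* (s :* i :* h)) refl
            (Y + X) ((Y + X) ⁻¹) s h)))))

    -- With X = √ p x and Y = √ p y one has
    --   2 (Y³ − X³) = (Y² − X²) (3 Y + (X − Y) q),  q = (2 X + Y) / (X + Y) ∈ [0 , 2],
    -- which holds also for X = Y = 0; so √ p ³ is differentiable at zeros of p.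
    Derivative-√³ : ∀ {p p′} → NonnegOn u v p → Derivative u v p p′ →
      Derivative u v (λ x → (1# + 1#) * (√ p x * p x)) (λ x → p′ x * ((1# + 1# + 1#) * √ p x))
    Derivative-√³ {u} {v} {p} {p′} 0≤p (derivative c s eq l) = derivative
      (Continuous-* (Continuous-const _) (Continuous-* cw c))
      (λ τ → s τ * ((1# + 1# + 1#) * √ p (right τ) + (√ p (left τ) - √ p (right τ)) * q τ))
      (λ τ → quot (√-nonneg _) (√-nonneg _) (√-square (0≤p _ (u≤left τ) (left≤v τ)))
         (√-square (0≤p _ (u≤right τ) (right≤v τ))) (eq τ))
      -- The correction (X - Y) q is a null factor times a bounded one, so only 3 √ p survives in
      -- the limit, even where it is 0.
      (~-* l (~-+null (~-* (~-refl (Bounded-const _)) (atRight cw)) bdN nullN))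
      where
      cw : Continuous u v (λ x → √ p x)
      cw = Continuous-√ 0≤p c
      ratio : Carrier → Carrier → Carrier
      ratio X Y = (X + X + Y) ÷ (X + Y)
      q : Triple {u} {v} → Carrier
      q τ = ratio (√ p (left τ)) (√ p (right τ))
      ratio-bound : ∀ {X Y} → 0# ≤ X → 0# ≤ Y → ∣ ratio X Y ∣≤ 1# + 1#
      ratio-bound {X} {Y} 0≤X 0≤Y with zero? (X + Y)
      -- Both square roots vanish here, and the convention 0⁻¹ = 0 gives the ratio the value 0.
      ... | inj₁ e = abs-resp (sym (trans (*-congˡ (0⁻¹ e)) (zeroʳ _))) refl (abs-0 (<⇒≤ 0<2))
      ... | inj₂ ne = mk
        (0≤y-x⇒x≤y (*-cancelˡ-≤0 0<X+Y (≤-respʳ-≈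
          (trans (solve 3 (λ x y i → y := (x :+ y) :* (:1 :+ :1) :- (x :+ x :+ y)) refl X Y 0#)
            (trans (+-congˡ (-‿cong (sym (÷-cancel (X + X + Y) 0<X+Y))))
              (solve 3 (λ z r o → z :* (:1 :+ :1) :- r :* z := z :* (:1 :+ :1 :- r)) refl
                (X + Y) (ratio X Y) 0#))) 0≤Y)))
        (by-≤ (+-nonneg (<⇒≤ 0<2) (*-nonneg (+-nonneg (+-nonneg 0≤X 0≤X) 0≤Y) (<⇒≤ (⁻¹-pos 0<X+Y))))
          (solve 1 (λ r → :1 :+ :1 :- :- r := :1 :+ :1 :+ r) refl (ratio X Y)))
        where
        0<X+Y : 0# < X + Y
        0<X+Y = +-nonneg 0≤X 0≤Y , λ e → ne (sym e)
      quot : ∀ {X Y px py s h} → 0# ≤ X → 0# ≤ Y → X * X ≈ px → Y * Y ≈ py → py - px ≈ s * h →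
        (1# + 1#) * (Y * py) - (1# + 1#) * (X * px)
          ≈ s * ((1# + 1# + 1#) * Y + (X - Y) * ratio X Y) * h
      quot {X} {Y} {px} {py} {s} {h} 0≤X 0≤Y X² Y² e =
        trans (+-cong (*-congˡ (*-congˡ (sym Y²))) (-‿cong (*-congˡ (*-congˡ (sym X²)))))
        (trans (solve 2 (λ x y → (:1 :+ :1) :* (y :* (y :* y)) :- (:1 :+ :1) :* (x :* (x :* x))
             := (y :* y :- x :* x) :* ((:1 :+ :1 :+ :1) :* y)
                 :- (x :- y) :* (x :- y) :* (x :+ x :+ y)) refl X Y)
        (trans (+-congˡ (-‿cong (*-congˡ (sym cancelled))))
        (trans (solve 3 (λ x y r → (y :* y :- x :* x) :* ((:1 :+ :1 :+ :1) :* y)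
                 :- (x :- y) :* (x :- y) :* (r :* (x :+ y))
               := (y :* y :- x :* x) :* ((:1 :+ :1 :+ :1) :* y :+ (x :- y) :* r)) refl X Y (ratio X Y))
        (trans (*-congʳ (trans (+-cong Y² (-‿cong X²)) e))
          (solve 3 (λ s h k → s :* h :* k := s :* k :* h) refl s h _)))))
        where
        cancelled : ratio X Y * (X + Y) ≈ X + X + Y
        cancelled with zero? (X + Y)
        ... | inj₂ ne = ÷-cancel _ (+-nonneg 0≤X 0≤Y , λ e → ne (sym e))
        ... | inj₁ z = trans (*-congˡ z) (trans (zeroʳ _) (sym (trans (+-assoc X X Y)
                (trans (+-congˡ z) (trans (+-identityʳ X) X≈0)))))
          where
          X≈0 : X ≈ 0#
          X≈0 = antisym (≤-respʳ-≈ z (by-≤ 0≤Y (solve 2 (λ x y → x :+ y :- x := y) refl X Y))) 0≤X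
      bdq : Bounded q
      bdq = 1# + 1# , 0<2 , λ τ → ratio-bound (√-nonneg _) (√-nonneg _)
      difference : (λ (τ : Triple {u} {v}) → √ p (left τ) + (0# - 1#) * √ p (right τ))
                 ~ (λ τ → √ p (mid τ) + (0# - 1#) * √ p (mid τ))
      difference = ~-+ (atLeft cw) (~-* (~-refl (Bounded-const _)) (atRight cw))
      bdN : Bounded (λ τ → (√ p (left τ) - √ p (right τ)) * q τ)
      bdN = Bounded-* (Bounded-resp (λ τ → solve 2 (λ x y → x :+ (:0 :- :1) :* y := x :- y)
        refl (√ p (left τ)) (√ p (right τ))) (boundedˡ difference)) bdq
      nullN : Null (λ τ → (√ p (left τ) - √ p (right τ)) * q τ)
      nullN = Null-resp (λ τ → *-comm _ _) (Null-* bdq (Null-resp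
        (λ τ → solve 3 (λ x y t → x :+ (:0 :- :1) :* y :- (t :+ (:0 :- :1) :* t) := x :- y) refl
          (√ p (left τ)) (√ p (right τ)) (√ p (mid τ))) (null difference)))

    -- Replaces the extreme value theorem: near x, half of `f x` is a lower bound, and on a union of
    -- two intervals the smaller of their bounds serves.
    positive-lower-bound : ∀ {f} → u ≤ v → Continuous u v f →
      (∀ x → u ≤ x → x ≤ v → 0# < f x) →
      ∃[ m ] 0# < m × (∀ x → u ≤ x → x ≤ v → m ≤ f x)
    positive-lower-bound {u} {v} {f} u≤v (continuous l r) 0<f =
      cousin u≤v (λ s t → ∃[ m ] 0# < m × (∀ z → s ≤ z → z ≤ t → m ≤ f z)) join local
      where
      join : ∀ {x y z} → x ≤ y → y ≤ z →
        (∃[ m ] 0# < m × (∀ c → x ≤ c → c ≤ y → m ≤ f c)) →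
        (∃[ m ] 0# < m × (∀ c → y ≤ c → c ≤ z → m ≤ f c)) →
        (∃[ m ] 0# < m × (∀ c → x ≤ c → c ≤ z → m ≤ f c))
      join {x} {y} {z} _ _ (m , 0<m , bm) (n , 0<n , bn) with minPos 0<m 0<n
      ... | k , 0<k , k≤m , k≤n = k , 0<k , bk
        where
        bk : ∀ c → x ≤ c → c ≤ z → k ≤ f c
        bk c x≤c c≤z with total c y
        ... | inj₁ c≤y = ≤-trans k≤m (bm c x≤c c≤y)
        ... | inj₂ y≤c = ≤-trans k≤n (bn c y≤c c≤z)
      local : ∀ x → u ≤ x → x ≤ v → ∃[ δ ] 0# < δ × (∀ s t → u ≤ s → s ≤ x → x ≤ t → t ≤ v →
        t - s < δ → ∃[ m ] 0# < m × (∀ z → s ≤ z → z ≤ t → m ≤ f z))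
      local x u≤x x≤v with halve (0<f x u≤x x≤v)
      ... | h , 0<h , h+h≈fx with null l h 0<h | null r h 0<h
      ... | δ₁ , 0<δ₁ , lδ | δ₂ , 0<δ₂ , rδ with minPos 0<δ₁ 0<δ₂
      ... | δ , 0<δ , δ≤δ₁ , δ≤δ₂ = δ , 0<δ , λ s t u≤s s≤x x≤t t≤v t-s<δ → h , 0<h , λ z s≤z z≤t →
        bound z (≤-trans u≤s s≤z) (≤-trans z≤t t≤v)
          (λ z≤x → ≤-<-trans (by-≤ (+-nonneg (x≤y⇒0≤y-x x≤t) (x≤y⇒0≤y-x s≤z))
            (solve 4 (λ s t x z → t :- s :- (x :- z) := t :- x :+ (z :- s)) refl s t x z)) t-s<δ)
          (λ x≤z → ≤-<-trans (by-≤ (+-nonneg (x≤y⇒0≤y-x z≤t) (x≤y⇒0≤y-x s≤x))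
            (solve 4 (λ s t x z → t :- s :- (z :- x) := t :- z :+ (x :- s)) refl s t x z)) t-s<δ)
        where
        close : ∀ {z} → ∣ f z - f x ∣≤ h → h ≤ f z
        close {z} (mk _ b) = by-≤ (x≤y⇒0≤y-x b)
          (trans (+-congʳ (trans (solve 2 (λ z x → z := x :+ (z :- x)) refl (f z) (f x))
                             (+-congʳ (sym h+h≈fx))))
            (solve 3 (λ h z x → h :+ h :+ (z :- x) :- h := h :- :- (z :- x)) refl h (f z) (f x)))
        bound : ∀ z → u ≤ z → z ≤ v → (z ≤ x → x - z < δ) → (x ≤ z → z - x < δ) → h ≤ f z
        bound z u≤z z≤v p q with total z x
        ... | inj₁ z≤x = close (lδ (triple u≤z z≤x ≤-refl x≤v) (<-≤-trans (p z≤x) δ≤δ₁))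
        ... | inj₂ x≤z = close (rδ (triple u≤x ≤-refl x≤z z≤v) (<-≤-trans (q x≤z) δ≤δ₂))

  Tagged-≤ : ∀ {a b} → Tagged a b → a ≤ b
  Tagged-≤ (done a≈b)         = ≤-reflexive a≈b
  Tagged-≤ (step t y p q P) = ≤-trans (≤-trans p q) (Tagged-≤ P)

  abstract
    -- Partitions grow only at their left end. Hence the property given to `cousin` is that a fine
    -- partition of [t , v] extends to one of [s , v], and joining is composition.
    fine-partition : ∀ {δ} → u ≤ v → 0# < δ → ∃ λ (P : Tagged u v) → MeshBelow δ P
    fine-partition {u} {v} {δ} u≤v 0<δ =
      cousin u≤v (λ s t → (∃ λ (P : Tagged t v) → MeshBelow δ P) → ∃ λ (P : Tagged s v) → MeshBelow δ P)
        (λ _ _ f g P → f (g P))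
        (λ x _ _ → δ , 0<δ , λ s t _ s≤x x≤t _ t-s<δ (P , m) →
          step s t ≤-refl (≤-trans s≤x x≤t) P , t-s<δ , m)
        (done refl , tt)

    -- Each term f t (y - x) differs from the increment Φ y - Φ x, which is slope times mesh, by at
    -- most ε (y - x); these errors add up along the partition. The left end x moves in the
    -- induction while all triples stay in [u , v].
    telescope : ∀ {Φ f ε δ} (D : Derivative u v Φ f) →
      (∀ τ → mesh τ < δ → ∣ slope D τ - f (mid τ) ∣≤ ε) →
      ∀ {x} (P : Tagged x v) → u ≤ x → MeshBelow δ P →
      ∣ riemannSum f P - (Φ v - Φ x) ∣≤ ε * (v - x)
    telescope {u} {v} {Φ} {f} {ε} D small {x} (done x≈v) u≤x _ =
      abs-resp (sym (trans (+-congˡ (-‿cong increment)) (-‿inverseʳ 0#)))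
        (sym (trans (*-congˡ v-x≈0) (zeroʳ ε))) (abs-0 ≤-refl)
      where
      v-x≈0 : v - x ≈ 0#
      v-x≈0 = trans (+-congʳ (sym x≈v)) (-‿inverseʳ x)
      increment : Φ v - Φ x ≈ 0#
      -- `Φ` is not assumed to respect `_≈_`; the difference quotient over a triple of mesh 0 gives
      -- what is needed.
      increment = trans (quotient D (triple u≤x ≤-refl (≤-reflexive x≈v) ≤-refl))
        (trans (*-congˡ v-x≈0) (zeroʳ _))
    telescope {u} {v} {Φ} {f} {ε} D small {x} (step t y x≤t t≤y P) u≤x (y-x<δ , m) =
      abs-resp sumEq (sym (solve 4 (λ e x y v → e :* (v :- x) := e :* (v :- y) :+ e :* (y :- x))
                             refl ε x y v))
        (abs-+ (telescope D small P u≤y m)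
               (abs-* (abs-swap (small τ y-x<δ)) (mk ≤-refl -mesh≤mesh)))
      where
      u≤y : u ≤ y
      u≤y = ≤-trans u≤x (≤-trans x≤t t≤y)
      τ : Triple {u} {v}
      τ = triple u≤x x≤t t≤y (Tagged-≤ P)
      -mesh≤mesh : - (y - x) ≤ y - x
      -mesh≤mesh = by-≤ (+-nonneg (mesh-nonneg τ) (mesh-nonneg τ))
        (solve 2 (λ x y → y :- x :- :- (y :- x) := y :- x :+ (y :- x)) refl x y)
      sumEq : riemannSum f P - (Φ v - Φ y) + (f t - slope D τ) * (y - x)
            ≈ f t * (y - x) + riemannSum f P - (Φ v - Φ x)
      sumEq = trans (solve 6 (λ R Φv Φy ft s h → R :- (Φv :- Φy) :+ (ft :- s) :* h
                  := ft :* h :+ R :- (Φv :- Φy) :- s :* h) refl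
                (riemannSum f P) (Φ v) (Φ y) (f t) (slope D τ) (y - x))
        (trans (+-congˡ (-‿cong (sym (quotient D τ))))
          (solve 4 (λ A Φv Φy Φx → A :- (Φv :- Φy) :- (Φy :- Φx) := A :- (Φv :- Φx)) refl
            (f t * (y - x) + riemannSum f P) (Φ v) (Φ y) (Φ x)))

    abs⇒within : ∀ {x y e ε} → ∣ x - y ∣≤ e → e < ε → Within ε x y
    abs⇒within p q = ≤-<-trans (upper p) q , ≤-<-trans (upper (abs-swap p)) q

    within⇒abs : ∀ {x y ε} → Within ε x y → ∣ x - y ∣≤ ε
    within⇒abs {x} {y} (p , q) = mk (<⇒≤ p)
      (≤-respˡ-≈ (solve 2 (λ x y → y :- x := :- (x :- y)) refl x y) (<⇒≤ q))

    fundamental-theorem : ∀ {Φ f} → u ≤ v → Derivative u v Φ f → Riemann f u v (Φ v - Φ u)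
    fundamental-theorem {u} {v} {Φ} {f} u≤v D ε 0<ε = fromSmall (null (limit D) e 0<e)
      where
      0<L : 0# < v - u + 1#
      0<L = +-posʳ (x≤y⇒0≤y-x u≤v) 0<1
      e : Carrier
      -- The added 1 keeps the divisor positive when u = v and makes the resulting bound strict.
      e = ε ÷ (v - u + 1#)
      0<e : 0# < e
      0<e = ÷-pos 0<ε 0<L
      small : e * (v - u) < ε
      small = by-< 0<e (trans (+-congʳ (sym (÷-cancel ε 0<L)))
        (solve 2 (λ e l → e :* (l :+ :1) :- e :* l := e) refl e (v - u)))
      fromSmall : (∃[ δ ] 0# < δ × (∀ τ → mesh τ < δ → ∣ slope D τ - f (mid τ) ∣≤ e)) →
        ∃ λ δ → 0# < δ × (∀ (P : Tagged u v) → MeshBelow δ P → Within ε (riemannSum f P) (Φ v - Φ u))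
      fromSmall (δ , 0<δ , s) = δ , 0<δ , λ P m → abs⇒within (telescope D s P ≤-refl m) small

    ≤-arbitrary : ∀ {x} → (∀ ε → 0# < ε → x ≤ ε) → x ≤ 0#
    ≤-arbitrary {x} p with x ≤? 0#
    ... | yes q = q
    ... | no ¬q with halve (≰⇒> ¬q)
    ... | h , 0<h , h+h≈x = ⊥-elim (<⇒≱ (by-< 0<h (trans (+-congʳ (sym h+h≈x))
        (solve 1 (λ h → h :+ h :- h := h) refl h))) (p h 0<h))

    -- `OpenImproper` speaks of every value `J` of an inner integral; uniqueness identifies it with
    -- the increment of the antiderivative. Both integrals are compared with the sum over one
    -- partition fine enough for each.
    Riemann-unique : ∀ {f I J} → u ≤ v → Riemann f u v I → Riemann f u v J → I ≈ J
    Riemann-unique {u} {v} {f} {I} {J} u≤v rI rJ = antisym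
      (0≤y-x⇒x≤y (≤-respʳ-≈ (solve 2 (λ i j → :0 :- (i :- j) := j :- i) refl I J)
        (x≤y⇒0≤y-x (≤-arbitrary λ ε 0<ε → upper (close ε 0<ε)))))
      (0≤y-x⇒x≤y (≤-respʳ-≈ (solve 2 (λ i j → :0 :- (j :- i) := i :- j) refl I J)
        (x≤y⇒0≤y-x (≤-arbitrary λ ε 0<ε → upper (abs-swap (close ε 0<ε))))))
      where
      close : ∀ ε → 0# < ε → ∣ I - J ∣≤ ε
      close ε 0<ε with halve 0<ε
      ... | h , 0<h , h+h≈ε with rI h 0<h | rJ h 0<h
      ... | δ₁ , 0<δ₁ , sI | δ₂ , 0<δ₂ , sJ with minPos 0<δ₁ 0<δ₂
      ... | δ , 0<δ , δ≤δ₁ , δ≤δ₂ with fine-partition u≤v 0<δ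
      ... | P , m = abs-resp (solve 3 (λ s i j → i :- s :+ (s :- j) := i :- j) refl (riemannSum f P) I J)
        h+h≈ε (abs-+ (abs-swap (within⇒abs (sI P (coarsen δ≤δ₁ P m)))) (within⇒abs (sJ P (coarsen δ≤δ₂ P m))))
        where
        coarsen : ∀ {δ δ′ x} → δ ≤ δ′ → (P : Tagged x v) → MeshBelow δ P → MeshBelow δ′ P
        coarsen p (done _)         _       = tt
        coarsen p (step _ _ _ _ P) (m , n) = <-≤-trans m p , coarsen p P n

    open-improper : ∀ {Φ f a b} → Continuous a b Φ →
      (∀ u v → a < u → u ≤ v → v < b → Derivative u v Φ f) →
      OpenImproper f a b (Φ b - Φ a)
    open-improper {Φ} {f} {a} {b} (continuous l r) D =
      (λ u v a<u u≤v v<b → Φ v - Φ u , fundamental-theorem u≤v (D u v a<u u≤v v<b)) , tendsto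
      where
      tendsto : ∀ ε → 0# < ε → ∃ λ δ → 0# < δ ×
        (∀ u v J → a < u → u < a + δ → u ≤ v → b - δ < v → v < b → Riemann f u v J →
          Within ε J (Φ b - Φ a))
      -- Each end contributes an error of at most ε/4; the remaining half of ε yields the strict
      -- inequalities in `Within`.
      tendsto ε 0<ε with halve 0<ε
      ... | e , 0<e , e+e≈ε with halve 0<e
      ... | h , 0<h , h+h≈e with null l h 0<h | null r h 0<h
      ... | δ₁ , 0<δ₁ , lδ | δ₂ , 0<δ₂ , rδ with minPos 0<δ₁ 0<δ₂
      ... | δ , 0<δ , δ≤δ₁ , δ≤δ₂ = δ , 0<δ , λ u v J a<u u<a+δ u≤v b-δ<v v<b rJ →
        let a≤b = ≤-trans (<⇒≤ a<u) (≤-trans u≤v (<⇒≤ v<b))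
            v~b = lδ (triple (≤-trans (<⇒≤ a<u) u≤v) (<⇒≤ v<b) ≤-refl ≤-refl)
                    (<-≤-trans (by-< (x<y⇒0<y-x b-δ<v)
                      (solve 3 (λ d b v → d :- (b :- v) := v :- (b :- d)) refl δ b v)) δ≤δ₁)
            u~a = rδ (triple ≤-refl ≤-refl (<⇒≤ a<u) (≤-trans u≤v (<⇒≤ v<b)))
                    (<-≤-trans (by-< (x<y⇒0<y-x u<a+δ)
                      (solve 3 (λ d a u → d :- (u :- a) := a :+ d :- u) refl δ a u)) δ≤δ₂)
        in abs⇒within
          (abs-resp (trans (solve 4 (λ v b u a → v :- b :+ :- (u :- a) := v :- u :- (b :- a)) refl
                        (Φ v) (Φ b) (Φ u) (Φ a))
              (+-congʳ (Riemann-unique u≤v (fundamental-theorem u≤v (D u v a<u u≤v v<b)) rJ)))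
            h+h≈e (abs-+ v~b (abs-neg u~a)))
          (by-< 0<e (trans (+-congʳ (sym e+e≈ε)) (solve 1 (λ e → e :+ e :- e := e) refl e)))

-- Cutting an interval at the zeros of polynomials.

module Partition (ℝ : Reals) where
  open Reals ℝ hiding (zero)
  open Analysis ℝ
  open RingSolver commutativeRing
  open OrderedField ℝ
  open Completeness ℝ
  open Differentiation ℝ
  open Integration ℝ

  -- The quotient of a ∷ p by X − c, whatever a is (Horner's scheme).
  quotientAt : Carrier → Poly → Poly
  quotientAt c []      = []
  quotientAt c (b ∷ p) = eval (b ∷ p) c ∷ quotientAt c p

  length-quotientAt : ∀ c p → length (quotientAt c p) ≡ length p
  length-quotientAt c []      = ≡.refl
  length-quotientAt c (b ∷ p) = ≡.cong suc (length-quotientAt c p)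

  abstract
    eval-quotientAt : ∀ c p x → x * eval p x - c * eval p c ≈ (x - c) * eval (quotientAt c p) x
    eval-quotientAt c []      x =
      solve 2 (λ x c → x :* :0 :- c :* :0 := (x :- c) :* :0) refl x c
    eval-quotientAt c (b ∷ p) x = trans
      (solve 5 (λ x c b px pc → x :* (b :+ x :* px) :- c :* (b :+ c :* pc)
        := (x :- c) :* (b :+ c :* pc) :+ x :* (x :* px :- c :* pc)) refl x c b (eval p x) (eval p c))
      (trans (+-congˡ (*-congˡ (eval-quotientAt c p x)))
        (solve 4 (λ x c q r → (x :- c) :* q :+ x :* ((x :- c) :* r) := (x :- c) :* (q :+ x :* r))
          refl x c (eval (b ∷ p) c) (eval (quotientAt c p) x)))

    eval-factor : ∀ c a p x → eval (a ∷ p) c ≈ 0# →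
      eval (a ∷ p) x ≈ (x - c) * eval (quotientAt c p) x
    eval-factor c a p x root = trans
      (trans (solve 4 (λ a x px cpc → a :+ x :* px := (a :+ cpc) :+ (x :* px :- cpc)) refl
          a x (eval p x) (c * eval p c))
        (trans (+-congʳ root) (+-identityˡ _)))
      (eval-quotientAt c p x)

    -- Induction on the length of q. If q has a zero c in (a , b), the quotient by X - c treats
    -- [a , c] and [c , b] separately, where c is never an interior point, so the zeros need not be
    -- listed or ordered. Being nonzero is witnessed by a point z, which still works for the
    -- quotient.
    split-at-zeros : (Q : Carrier → Carrier → Set) →
      (∀ {x y z} → x < y → y < z → Q x y → Q y z → Q x z) →
      ∀ n q → length q ≡ n → (∃[ z ] ¬ (eval q z ≈ 0#)) → ∀ a b → a < b →
      (∀ s t → a ≤ s → s < t → t ≤ b → (∀ x → s < x → x < t → ¬ (eval q x ≈ 0#)) → Q s t) →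
      Q a b
    split-at-zeros Q join n       []       _  (z , q≉0) _ _ _ _ = ⊥-elim (q≉0 refl)
    split-at-zeros Q join (suc n) (a₀ ∷ p) ln (z , q≉0) a b a<b zeroFree
      with excludedMiddle (∃[ c ] a < c × c < b × eval (a₀ ∷ p) c ≈ 0#)
    ... | inj₂ none = zeroFree a b ≤-refl a<b ≤-refl λ x a<x x<b qx≈0 → none (x , a<x , x<b , qx≈0)
    ... | inj₁ (c , a<c , c<b , qc≈0) = join a<c c<b
      (split-at-zeros Q join n r length-r r≉0 a c a<c λ s t a≤s s<t t≤c r≉0 →
        zeroFree s t a≤s s<t (≤-trans t≤c (<⇒≤ c<b)) λ x s<x x<t →
          product (λ x-c≈0 → <⇒≱ (x<y⇒0<y-x (<-≤-trans x<t t≤c))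
            (≤-reflexive (trans (solve 2 (λ x c → c :- x := :0 :- (x :- c)) refl x c)
              (trans (+-congˡ (-‿cong x-c≈0)) (-‿inverseʳ 0#))))) (r≉0 x s<x x<t))
      (split-at-zeros Q join n r length-r r≉0 c b c<b λ s t c≤s s<t t≤b r≉0 →
        zeroFree s t (≤-trans (<⇒≤ a<c) c≤s) s<t t≤b λ x s<x x<t →
          product (pos⇒≉0 (x<y⇒0<y-x (≤-<-trans c≤s s<x))) (r≉0 x s<x x<t))
      where
      r : Poly
      r = quotientAt c p
      length-r : length r ≡ n
      length-r = ≡.trans (length-quotientAt c p) (≡.cong ℕ.pred ln)
      r≉0 : ∃[ z ] ¬ (eval r z ≈ 0#)
      r≉0 = z , λ e → q≉0 (trans (eval-factor c a₀ p z qc≈0) (trans (*-congˡ e) (zeroʳ _)))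
      product : ∀ {x} → ¬ (x - c ≈ 0#) → ¬ (eval r x ≈ 0#) → ¬ (eval (a₀ ∷ p) x ≈ 0#)
      product {x} x≉c rx≉0 e = rx≉0 (integral (trans (sym (eval-factor c a₀ p x qc≈0)) e) x≉c)

    Improper-resp : ∀ {S f a b I J} → I ≈ J → Improper S f a b I → Improper S f a b J
    Improper-resp I≈J (done a≈b I≈0)               = done a≈b (trans (sym I≈J) I≈0)
    Improper-resp I≈J (step c J K a<c S o P I≈J+K) = step c J K a<c S o P (trans (sym I≈J) I≈J+K)

    -- An `Improper` integral is built from the right, so `Q s t` says that any integral from t
    -- onwards extends to one from s, and joining is composition with telescoping increments. Each
    -- piece cut by q₁ is cut again by q₂; the empty integral at b starts the construction.
    improper-fundamental-theorem : ∀ {a b Φ f} {S : Carrier → Set} (q₁ q₂ : Poly) →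
      (∃[ z ] ¬ (eval q₁ z ≈ 0#)) → (∃[ z ] ¬ (eval q₂ z ≈ 0#)) →
      (∀ x → a ≤ x → x ≤ b → ¬ (eval q₁ x ≈ 0#) → ¬ (eval q₂ x ≈ 0#) → S x) →
      a < b → (∀ u v → a ≤ u → v ≤ b → Continuous u v Φ) →
      (∀ u v → a ≤ u → u ≤ v → v ≤ b → (∀ x → u ≤ x → x ≤ v → S x) → Derivative u v Φ f) →
      Improper S f a b (Φ b - Φ a)
    improper-fundamental-theorem {a} {b} {Φ} {f} {S} q₁ q₂ q₁≉0 q₂≉0 inS a<b C D =
      Improper-resp (+-identityʳ _)
        (split-at-zeros Q join (length q₁) q₁ ≡.refl q₁≉0 a b a<b
          (λ s t a≤s s<t t≤b free₁ → split-at-zeros Q join (length q₂) q₂ ≡.refl q₂≉0 s t s<t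
            (λ s′ t′ s≤s′ s′<t′ t′≤t free₂ → prepend s′ t′ (≤-trans a≤s s≤s′) s′<t′ (≤-trans t′≤t t≤b)
              (λ x s′<x x<t′ → free₁ x (≤-<-trans s≤s′ s′<x) (<-≤-trans x<t′ t′≤t)) free₂))
          b 0# (done refl refl))
      where
      Q : Carrier → Carrier → Set
      Q s t = ∀ e K → Improper S f t e K → Improper S f s e (Φ t - Φ s + K)
      join : ∀ {x y z} → x < y → y < z → Q x y → Q y z → Q x z
      join {x} {y} {z} _ _ P R e K T = Improper-resp
        (solve 4 (λ x y z k → y :- x :+ (z :- y :+ k) := z :- x :+ k) refl (Φ x) (Φ y) (Φ z) K)
        (P e _ (R e K T))
      prepend : ∀ s t → a ≤ s → s < t → t ≤ b →
        (∀ x → s < x → x < t → ¬ (eval q₁ x ≈ 0#)) →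
        (∀ x → s < x → x < t → ¬ (eval q₂ x ≈ 0#)) → Q s t
      prepend s t a≤s s<t t≤b free₁ free₂ e K T = step t (Φ t - Φ s) K s<t interior
        (open-improper (C s t a≤s t≤b) λ u v s<u u≤v v<t →
          D u v (≤-trans a≤s (<⇒≤ s<u)) u≤v (≤-trans (<⇒≤ v<t) t≤b) λ x u≤x x≤v →
            interior x (<-≤-trans s<u u≤x) (≤-<-trans x≤v v<t))
        T refl
        where
        interior : ∀ x → s < x → x < t → S x
        interior x s<x x<t = inS x (≤-trans a≤s (<⇒≤ s<x)) (≤-trans (<⇒≤ x<t) t≤b)
          (free₁ x s<x x<t) (free₂ x s<x x<t)

-- Identities and derivatives for the Fibonacci- and Lucas-type sequences.

module Recurrences (ℝ : Reals) where
  open Reals ℝ hiding (zero)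
  open Analysis ℝ
  open RingSolver commutativeRing
  open Differentiation ℝ

  nat : ℕ → Carrier
  nat n = n · 1#

  module Sequences (k : Carrier) where

    -- F n y is the Fibonacci-type polynomial as a function of y = d(x), with
    -- derivatives F′, F″ with respect to y; V is the Lucas-type sequence 2, y, ….
    F F′ F″ V : ℕ → Carrier → Carrier
    F zero          y = 0#
    F (suc zero)    y = 1#
    F (suc (suc n)) y = y * F (suc n) y + k * F n y

    F′ zero          y = 0#
    F′ (suc zero)    y = 0#
    F′ (suc (suc n)) y = 1# * F (suc n) y + y * F′ (suc n) y + k * F′ n y

    F″ zero          y = 0#
    F″ (suc zero)    y = 0#
    F″ (suc (suc n)) y = (1# + 1#) * F′ (suc n) y + y * F″ (suc n) y + k * F″ n y

    V zero          y = 1# + 1#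
    V (suc zero)    y = y
    V (suc (suc n)) y = y * V (suc n) y + k * V n y

    p : Carrier → Carrier
    p y = - (4 · k) - y * y

    abstract
      -- This is w² F′ = y F - n V at index n + 1, with V eliminated by `V-suc`. Since only
      -- consecutive terms of F occur, the two preceding cases reduce the induction step to a
      -- polynomial identity.
      pF′-suc : ∀ n y → p y * F′ (suc n) y
        ≈ - (nat n * y * F (suc n) y + (1# + 1#) * (1# + nat n) * k * F n y)
      pF′-suc zero y = solve 2
        (λ k y → (:- (4 :· k) :- y :* y) :* :0
          := :- (:0 :* y :* :1 :+ (:1 :+ :1) :* (:1 :+ :0) :* k :* :0)) refl k y
      pF′-suc (suc zero) y = solve 2
        (λ k y → (:- (4 :· k) :- y :* y) :* (:1 :* :1 :+ y :* :0 :+ k :* :0)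
          := :- ((:1 :+ :0) :* y :* (y :* :1 :+ k :* :0)
                 :+ (:1 :+ :1) :* (:1 :+ (:1 :+ :0)) :* k :* :1)) refl k y
      pF′-suc (suc (suc n)) y = trans
        (solve 6 (λ p y k f2 f2′ f1′ → p :* (:1 :* f2 :+ y :* f2′ :+ k :* f1′)
          := p :* f2 :+ y :* (p :* f2′) :+ k :* (p :* f1′)) refl
          (p y) y k (F (suc (suc n)) y) (F′ (suc (suc n)) y) (F′ (suc n) y))
        (trans (+-cong (+-congˡ (*-congˡ (pF′-suc (suc n) y))) (*-congˡ (pF′-suc n y)))
          (solve 5 (λ n y k f1 f0 →
            (:- (4 :· k) :- y :* y) :* (y :* f1 :+ k :* f0)
              :+ y :* :- ((:1 :+ n) :* y :* (y :* f1 :+ k :* f0)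
                          :+ (:1 :+ :1) :* (:1 :+ (:1 :+ n)) :* k :* f1)
              :+ k :* :- (n :* y :* f1 :+ (:1 :+ :1) :* (:1 :+ n) :* k :* f0)
            := :- ((:1 :+ (:1 :+ n)) :* y :* (y :* (y :* f1 :+ k :* f0) :+ k :* f1)
                 :+ (:1 :+ :1) :* (:1 :+ (:1 :+ (:1 :+ n))) :* k :* (y :* f1 :+ k :* f0)))
            refl (nat n) y k (F (suc n) y) (F n y)))

      -- The left-hand side obeys the recurrence of F, up to twice pF′-suc.
      differential-equation : ∀ n y →
        p y * F″ n y - (1# + 1# + 1#) * y * F′ n y ≈ (1# - nat n * nat n) * F n y
      differential-equation zero y = solve 2
        (λ p y → p :* :0 :- (:1 :+ :1 :+ :1) :* y :* :0 := (:1 :- :0 :* :0) :* :0) refl (p y) y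
      differential-equation (suc zero) y = solve 2
        (λ p y → p :* :0 :- (:1 :+ :1 :+ :1) :* y :* :0
          := (:1 :- (:1 :+ :0) :* (:1 :+ :0)) :* :1) refl (p y) y
      differential-equation (suc (suc n)) y = trans
        (solve 9 (λ p y k f1 f0 f1′ f0′ f1″ f0″ →
          p :* ((:1 :+ :1) :* f1′ :+ y :* f1″ :+ k :* f0″)
            :- (:1 :+ :1 :+ :1) :* y :* (:1 :* f1 :+ y :* f1′ :+ k :* f0′)
          := (:1 :+ :1) :* (p :* f1′) :- (:1 :+ :1 :+ :1) :* y :* f1
            :+ y :* (p :* f1″ :- (:1 :+ :1 :+ :1) :* y :* f1′)
            :+ k :* (p :* f0″ :- (:1 :+ :1 :+ :1) :* y :* f0′)) refl
          (p y) y k (F (suc n) y) (F n y) (F′ (suc n) y) (F′ n y) (F″ (suc n) y) (F″ n y))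
        (trans (+-cong (+-cong (+-congʳ (*-congˡ (pF′-suc n y)))
                               (*-congˡ (differential-equation (suc n) y)))
                       (*-congˡ (differential-equation n y)))
          (solve 5 (λ n y k f1 f0 →
            (:1 :+ :1) :* :- (n :* y :* f1 :+ (:1 :+ :1) :* (:1 :+ n) :* k :* f0)
              :- (:1 :+ :1 :+ :1) :* y :* f1
              :+ y :* ((:1 :- (:1 :+ n) :* (:1 :+ n)) :* f1)
              :+ k :* ((:1 :- n :* n) :* f0)
            := (:1 :- (:1 :+ (:1 :+ n)) :* (:1 :+ (:1 :+ n))) :* (y :* f1 :+ k :* f0))
            refl (nat n) y k (F (suc n) y) (F n y)))

      -- Both sides satisfy the same recurrence in n, so the cases 0 and 1 decide.
      V-suc : ∀ n y → V (suc n) y ≈ y * F (suc n) y + (1# + 1#) * k * F n y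
      V-suc zero y = solve 2 (λ k y → y := y :* :1 :+ (:1 :+ :1) :* k :* :0) refl k y
      V-suc (suc zero) y = solve 2
        (λ k y → y :* y :+ k :* (:1 :+ :1)
          := y :* (y :* :1 :+ k :* :0) :+ (:1 :+ :1) :* k :* :1) refl k y
      V-suc (suc (suc n)) y = trans
        (+-cong (*-congˡ (V-suc (suc n) y)) (*-congˡ (V-suc n y)))
        (solve 4 (λ y k f1 f0 →
          y :* (y :* (y :* f1 :+ k :* f0) :+ (:1 :+ :1) :* k :* f1)
            :+ k :* (y :* f1 :+ (:1 :+ :1) :* k :* f0)
          := y :* (y :* (y :* f1 :+ k :* f0) :+ k :* f1)
            :+ (:1 :+ :1) :* k :* (y :* f1 :+ k :* f0)) refl y k (F (suc n) y) (F n y))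

      pF′ : ∀ n y → p y * F′ n y ≈ y * F n y - nat n * V n y
      pF′ zero    y = solve 2 (λ p y → p :* :0 := y :* :0 :- :0 :* (:1 :+ :1)) refl (p y) y
      pF′ (suc n) y = trans (pF′-suc n y) (trans
        (solve 5 (λ n y k f1 f0 → :- (n :* y :* f1 :+ (:1 :+ :1) :* (:1 :+ n) :* k :* f0)
          := y :* f1 :- (:1 :+ n) :* (y :* f1 :+ (:1 :+ :1) :* k :* f0)) refl
          (nat n) y k (F (suc n) y) (F n y))
        (+-congˡ (-‿cong (*-congˡ (sym (V-suc n y))))))

      -- In place of a general chain rule, the recurrences are differentiated along the inner
      -- function d.
      module _ {u v : Carrier} {d d′ : Carrier → Carrier} (D : Derivative u v d d′) where

        Derivative-F : ∀ n → Derivative u v (λ x → F n (d x)) (λ x → F′ n (d x) * d′ x)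
        Derivative-F zero = Derivative-cong (λ _ _ _ → refl) (λ _ _ _ → sym (zeroˡ _)) (Derivative-const 0#)
        Derivative-F (suc zero) =
          Derivative-cong (λ _ _ _ → refl) (λ _ _ _ → sym (zeroˡ _)) (Derivative-const 1#)
        Derivative-F (suc (suc n)) = Derivative-cong (λ _ _ _ → refl)
          (λ x _ _ → solve 6 (λ y k d′ f1 f1′ f0′ → d′ :* f1 :+ y :* (f1′ :* d′) :+ k :* (f0′ :* d′)
            := (:1 :* f1 :+ y :* f1′ :+ k :* f0′) :* d′) refl
            (d x) k (d′ x) (F (suc n) (d x)) (F′ (suc n) (d x)) (F′ n (d x)))
          (Derivative-+ (Derivative-* D (Derivative-F (suc n))) (Derivative-scale k (Derivative-F n)))

        Derivative-F′ : ∀ n → Derivative u v (λ x → F′ n (d x)) (λ x → F″ n (d x) * d′ x)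
        Derivative-F′ zero = Derivative-cong (λ _ _ _ → refl) (λ _ _ _ → sym (zeroˡ _)) (Derivative-const 0#)
        Derivative-F′ (suc zero) =
          Derivative-cong (λ _ _ _ → refl) (λ _ _ _ → sym (zeroˡ _)) (Derivative-const 0#)
        Derivative-F′ (suc (suc n)) = Derivative-cong (λ _ _ _ → refl)
          (λ x _ _ → solve 6 (λ y k d′ f1′ f1″ f0″ →
              :1 :* (f1′ :* d′) :+ (d′ :* f1′ :+ y :* (f1″ :* d′)) :+ k :* (f0″ :* d′)
            := ((:1 :+ :1) :* f1′ :+ y :* f1″ :+ k :* f0″) :* d′) refl
            (d x) k (d′ x) (F′ (suc n) (d x)) (F″ (suc n) (d x)) (F″ n (d x)))
          (Derivative-+ (Derivative-+ (Derivative-scale 1# (Derivative-F (suc n)))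
            (Derivative-* D (Derivative-F′ (suc n)))) (Derivative-scale k (Derivative-F′ n)))

        Derivative-V : ∀ n → Derivative u v (λ x → V n (d x)) (λ x → nat n * F n (d x) * d′ x)
        Derivative-V zero = Derivative-cong (λ _ _ _ → refl)
          (λ x _ _ → solve 1 (λ d′ → :0 := :0 :* :0 :* d′) refl (d′ x)) (Derivative-const _)
        Derivative-V (suc zero) = Derivative-cong (λ _ _ _ → refl)
          (λ x _ _ → solve 1 (λ d′ → d′ := (:1 :+ :0) :* :1 :* d′) refl (d′ x)) D
        Derivative-V (suc (suc n)) = Derivative-cong (λ _ _ _ → refl)
          -- The product rule leaves one undifferentiated term V (n + 1), which `V-suc` turns into
          -- terms of F.
          (λ x _ _ → trans (+-congʳ (+-congʳ (*-congˡ (V-suc n (d x)))))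
            (solve 6 (λ n y k d′ f1 f0 →
              d′ :* (y :* f1 :+ (:1 :+ :1) :* k :* f0) :+ y :* ((:1 :+ n) :* f1 :* d′) :+ k :* (n :* f0 :* d′)
              := (:1 :+ (:1 :+ n)) :* (y :* f1 :+ k :* f0) :* d′) refl
              (nat n) (d x) k (d′ x) (F (suc n) (d x)) (F n (d x))))
          (Derivative-+ (Derivative-* D (Derivative-V (suc n))) (Derivative-scale k (Derivative-V n)))

-- The antiderivatives of both integrands and their increments.

module Orthogonality (ℝ : Reals) where
  open Reals ℝ hiding (zero)
  open Analysis ℝ
  open RingSolver commutativeRing
  open OrderedField ℝ
  open Completeness ℝ
  open Differentiation ℝ
  open Integration ℝ
  open Partition ℝ
  open Recurrences ℝ

  abstract
    eval-const : ∀ a x → eval (const a) x ≈ a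
    eval-const a x = solve 2 (λ a x → a :+ x :* :0 := a) refl a x

    eval-⊙ : ∀ a p x → eval (a ⊙ p) x ≈ a * eval p x
    eval-⊙ a []      x = sym (zeroʳ a)
    eval-⊙ a (b ∷ p) x = trans (+-congˡ (*-congˡ (eval-⊙ a p x)))
      (solve 4 (λ a b x p → a :* b :+ x :* (a :* p) := a :* (b :+ x :* p)) refl a b x (eval p x))

    eval-⊠ : ∀ p q x → eval (p ⊠ q) x ≈ eval p x * eval q x
    eval-⊠ []      q x = sym (zeroˡ _)
    eval-⊠ (a ∷ p) q x = trans (eval-⊞ (a ⊙ q) (0# ∷ (p ⊠ q)) x)
      (trans (+-cong (eval-⊙ a q x) (+-congˡ (*-congˡ (eval-⊠ p q x))))
        (solve 4 (λ a x p q → a :* q :+ (:0 :+ x :* (p :* q)) := (a :+ x :* p) :* q) refl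
          a x (eval p x) (eval q x)))

    eval-cong : ∀ p {x y} → x ≈ y → eval p x ≈ eval p y
    eval-cong []      e = refl
    eval-cong (a ∷ p) e = +-congˡ (*-cong e (eval-cong p e))

    eval-≐ : ∀ p q → p ≐ q → ∀ x → eval p x ≈ eval q x
    eval-≐ []      []      e x = refl
    eval-≐ []      (b ∷ q) e x = sym (trans (+-cong (sym (e 0))
      (*-congˡ (sym (eval-≐ [] q (λ i → e (suc i)) x)))) (trans (+-identityˡ _) (zeroʳ x)))
    eval-≐ (a ∷ p) []      e x = trans (+-cong (e 0)
      (*-congˡ (eval-≐ p [] (λ i → e (suc i)) x))) (trans (+-identityˡ _) (zeroʳ x))
    eval-≐ (a ∷ p) (b ∷ q) e x = +-cong (e 0) (*-congˡ (eval-≐ p q (λ i → e (suc i)) x))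

    nat-mono : ∀ {m n} → m ℕ.≤ n → nat m ≤ nat n
    nat-mono {n = zero}  ℕ.z≤n     = ≤-refl
    nat-mono {n = suc n} ℕ.z≤n     = +-nonneg 0≤1 (nat-mono {n = n} ℕ.z≤n)
    nat-mono             (ℕ.s≤s p) = +-mono-≤ ≤-refl (nat-mono p)

    square-difference-pos : ∀ {m n} → m ℕ.< n → 0# < nat n * nat n - nat m * nat m
    square-difference-pos {m} {suc n} (ℕ.s≤s m≤n) = <-respʳ-≈
      (solve 2 (λ m n → (n :- m) :* (n :+ m) := n :* n :- m :* m) refl (nat m) (nat (suc n)))
      (*-pos (x<y⇒0<y-x (≤-<-trans (nat-mono m≤n)
                (by-< 0<1 (solve 1 (λ n → :1 :+ n :- n := :1) refl (nat n)))))
             (+-pos (+-pos 0<1 (nat-mono {n = n} ℕ.z≤n)) (nat-mono {n = m} ℕ.z≤n)))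

    square-difference-≉0 : ∀ {m n} → n ≢ m → ¬ (nat m * nat m - nat n * nat n ≈ 0#)
    square-difference-≉0 {m} {n} n≢m e with ℕₚ.≤-total n m
    ... | inj₁ n≤m = pos⇒≉0 (square-difference-pos (ℕₚ.≤∧≢⇒< n≤m n≢m)) e
    ... | inj₂ m≤n = pos⇒≉0 (square-difference-pos (ℕₚ.≤∧≢⇒< m≤n (≡.≢-sym n≢m)))
      (trans (solve 2 (λ a b → b :- a := :0 :- (a :- b)) refl (nat m * nat m) (nat n * nat n))
        (trans (+-congˡ (-‿cong e)) (-‿inverseʳ 0#)))

    Riemann-resp : ∀ {f a b I J} → I ≈ J → Riemann f a b I → Riemann f a b J
    Riemann-resp {f} {I = I} {J} I≈J r ε 0<ε =
      let δ , 0<δ , rδ = r ε 0<ε in δ , 0<δ , λ P m →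
        <-respˡ-≈ (+-congˡ (-‿cong I≈J)) (proj₁ (rδ P m)) , <-respˡ-≈ (+-congʳ I≈J) (proj₂ (rδ P m))

  module Weight (k : Carrier) (d : Poly) where
    open Sequences k

    D D′ P P′ w : Carrier → Carrier
    D  x = eval d x
    D′ x = eval (deriv d) x
    P  x = - (4 · k) - D x * D x
    P′ x = - ((1# + 1#) * D x * D′ x)
    w  x = √ P x

    abstract
      eval-fibonacci : ∀ n x → eval (fibonacci d (const k) n) x ≈ F n (D x)
      eval-fibonacci zero          x = eval-const 0# x
      eval-fibonacci (suc zero)    x = eval-const 1# x
      eval-fibonacci (suc (suc n)) x = trans (eval-⊞ (d ⊠ _) (const k ⊠ _) x)
        (+-cong (trans (eval-⊠ d (fibonacci d (const k) (suc n)) x) (*-congˡ (eval-fibonacci (suc n) x)))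
          (trans (eval-⊠ (const k) (fibonacci d (const k) n) x)
            (*-cong (eval-const k x) (eval-fibonacci n x))))

      eval-lucas : ∀ {p₀ p₁} → (∀ x → (1# + 1#) * eval p₁ x ≈ p₀ * D x) →
        ∀ n x → (1# + 1#) * eval (lucas d (const k) p₀ p₁ n) x ≈ p₀ * V n (D x)
      eval-lucas {p₀} {p₁} e zero          x = trans (*-congˡ (eval-const p₀ x)) (*-comm _ _)
      eval-lucas {p₀} {p₁} e (suc zero)    x = e x
      eval-lucas {p₀} {p₁} e (suc (suc n)) x = trans
        (*-congˡ (trans (eval-⊞ (d ⊠ _) (const k ⊠ _) x)
          (+-cong (eval-⊠ d L₁ x) (trans (eval-⊠ (const k) L₀ x) (*-congʳ (eval-const k x))))))
        (trans (solve 4 (λ y k l₁ l₀ → (:1 :+ :1) :* (y :* l₁ :+ k :* l₀)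
            := y :* ((:1 :+ :1) :* l₁) :+ k :* ((:1 :+ :1) :* l₀)) refl (D x) k (eval L₁ x) (eval L₀ x))
          (trans (+-cong (*-congˡ (eval-lucas e (suc n) x)) (*-congˡ (eval-lucas e n x)))
            (solve 5 (λ p y k v₁ v₀ → y :* (p :* v₁) :+ k :* (p :* v₀) := p :* (y :* v₁ :+ k :* v₀))
              refl p₀ (D x) k (V (suc n) (D x)) (V n (D x)))))
        where
        L₁ L₀ : Poly
        L₁ = lucas d (const k) p₀ p₁ (suc n)
        L₀ = lucas d (const k) p₀ p₁ n

      Derivative-P : ∀ {u v} → Derivative u v P P′
      Derivative-P = Derivative-cong
        (λ x _ _ → solve 2 (λ c y → c :+ (:0 :- :1) :* (y :* y) := c :- y :* y) refl (- (4 · k)) (D x))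
        (λ x _ _ → solve 2 (λ y y′ → :0 :+ (:0 :- :1) :* (y′ :* y :+ y :* y′)
          := :- ((:1 :+ :1) :* y :* y′)) refl (D x) (D′ x))
        (Derivative-+ (Derivative-const (- (4 · k))) (Derivative-scale (0# - 1#)
          (Derivative-* (Derivative-eval d) (Derivative-eval d))))

    module Interval (a b : Carrier) (0≤P : NonnegOn a b P) (n m : ℕ) where

      -- By the differential equation of F, the Wronskian G of F n and F m satisfies
      -- (w³ G)′ = (m² − n²) w F n F m, primes denoting derivatives in y = d(x).
      G Φ : Carrier → Carrier
      G x = F′ n (D x) * F m (D x) - F n (D x) * F′ m (D x)
      Φ x = (1# + 1#) * (w x * P x) * G x

      -- Likewise (w H)′ = (m² − n²) V n V m / w.
      H Ψ : Carrier → Carrier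
      H x = nat n * F n (D x) * V m (D x) - nat m * F m (D x) * V n (D x)
      Ψ x = w x * H x

      Δ : Carrier
      Δ = nat m * nat m - nat n * nat n

      abstract
        Derivative-G : ∀ {u v} → Derivative u v G
          (λ x → (F″ n (D x) * F m (D x) - F n (D x) * F″ m (D x)) * D′ x)
        Derivative-G = Derivative-cong
          (λ x _ _ → solve 4 (λ n n′ m m′ → n′ :* m :+ (:0 :- :1) :* (n :* m′) := n′ :* m :- n :* m′) refl
            (F n (D x)) (F′ n (D x)) (F m (D x)) (F′ m (D x)))
          (λ x _ _ → solve 7 (λ n n′ n″ m m′ m″ y′ →
              n″ :* y′ :* m :+ n′ :* (m′ :* y′)
                :+ (:0 :- :1) :* (n′ :* y′ :* m′ :+ n :* (m″ :* y′))
              := (n″ :* m :- n :* m″) :* y′) refl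
            (F n (D x)) (F′ n (D x)) (F″ n (D x)) (F m (D x)) (F′ m (D x)) (F″ m (D x)) (D′ x))
          (Derivative-+ (Derivative-* (Derivative-F′ dD n) (Derivative-F dD m))
            (Derivative-scale (0# - 1#) (Derivative-* (Derivative-F dD n) (Derivative-F′ dD m))))
          where
          dD : ∀ {u v} → Derivative u v D D′
          dD = Derivative-eval d

        Derivative-H : ∀ {u v} → Derivative u v H
          (λ x → (nat n * F′ n (D x) * V m (D x) - nat m * F′ m (D x) * V n (D x)) * D′ x)
        Derivative-H = Derivative-cong
          (λ x _ _ → solve 6 (λ N M f v f₁ v₁ → N :* f :* v₁ :+ (:0 :- :1) :* (M :* f₁ :* v)
              := N :* f :* v₁ :- M :* f₁ :* v) refl
            (nat n) (nat m) (F n (D x)) (V n (D x)) (F m (D x)) (V m (D x)))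
          (λ x _ _ → solve 9 (λ N M f f′ v f₁ f₁′ v₁ y′ →
              N :* (f′ :* y′) :* v₁ :+ N :* f :* (M :* f₁ :* y′)
                :+ (:0 :- :1) :* (M :* (f₁′ :* y′) :* v :+ M :* f₁ :* (N :* f :* y′))
              := (N :* f′ :* v₁ :- M :* f₁′ :* v) :* y′) refl
            (nat n) (nat m) (F n (D x)) (F′ n (D x)) (V n (D x))
            (F m (D x)) (F′ m (D x)) (V m (D x)) (D′ x))
          (Derivative-+ (Derivative-* (Derivative-scale (nat n) (Derivative-F dD n)) (Derivative-V dD m))
            (Derivative-scale (0# - 1#)
              (Derivative-* (Derivative-scale (nat m) (Derivative-F dD m)) (Derivative-V dD n))))
          where
          dD : ∀ {u v} → Derivative u v D D′
          dD = Derivative-eval d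

        Derivative-Φ : Derivative a b Φ
          (λ x → (1# + 1#) * Δ * (F n (D x) * F m (D x) * w x * D′ x))
        Derivative-Φ = Derivative-cong (λ _ _ _ → refl) (λ x _ _ → pointwise x)
          (Derivative-* (Derivative-√³ 0≤P Derivative-P) Derivative-G)
          where
          pointwise : ∀ x →
            P′ x * ((1# + 1# + 1#) * w x) * G x
              + (1# + 1#) * (w x * P x) * ((F″ n (D x) * F m (D x) - F n (D x) * F″ m (D x)) * D′ x)
            ≈ (1# + 1#) * Δ * (F n (D x) * F m (D x) * w x * D′ x)
          -- The terms are collected into w² F″ - 3 y F′ for both indices; the differential equation
          -- leaves (1 - n²) - (1 - m²) = m² - n².
          pointwise x = trans
            (solve 10 (λ y y′ w p f f′ f″ g g′ g″ →
                :- ((:1 :+ :1) :* y :* y′) :* ((:1 :+ :1 :+ :1) :* w) :* (f′ :* g :- f :* g′)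
                  :+ (:1 :+ :1) :* (w :* p) :* ((f″ :* g :- f :* g″) :* y′)
                := (:1 :+ :1) :* w :* y′ :*
                   ((p :* f″ :- (:1 :+ :1 :+ :1) :* y :* f′) :* g
                     :- f :* (p :* g″ :- (:1 :+ :1 :+ :1) :* y :* g′))) refl
              (D x) (D′ x) (w x) (P x) (F n (D x)) (F′ n (D x)) (F″ n (D x))
              (F m (D x)) (F′ m (D x)) (F″ m (D x)))
            (trans (*-congˡ (+-cong (*-congʳ (differential-equation n (D x)))
                                    (-‿cong (*-congˡ (differential-equation m (D x))))))
              (solve 6 (λ y′ w N M f g → (:1 :+ :1) :* w :* y′ :*
                    ((:1 :- N :* N) :* f :* g :- f :* ((:1 :- M :* M) :* g))
                  := (:1 :+ :1) :* (M :* M :- N :* N) :* (f :* g :* w :* y′)) refl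
                (D′ x) (w x) (nat n) (nat m) (F n (D x)) (F m (D x))))

        Continuous-Ψ : ∀ u v → a ≤ u → v ≤ b → Continuous u v Ψ
        Continuous-Ψ u v a≤u v≤b = Continuous-*
          (Continuous-√ (λ x u≤x x≤v → 0≤P x (≤-trans a≤u u≤x) (≤-trans x≤v v≤b)) (cont Derivative-P))
          (cont Derivative-H)

        -- That w has no zero on the closed interval [u , v] is first strengthened by compactness to
        -- a positive lower bound, which `Derivative-√` requires.
        Derivative-Ψ : ∀ u v → a ≤ u → u ≤ v → v ≤ b → (∀ x → u ≤ x → x ≤ v → ¬ (w x ≈ 0#)) →
          Derivative u v Ψ (λ x → Δ * (V n (D x) * V m (D x) * (w x) ⁻¹ * D′ x))
        Derivative-Ψ u v a≤u u≤v v≤b w≉0 =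
          fromBound (positive-lower-bound u≤v (Continuous-√ 0≤P′ (cont Derivative-P))
            (λ x u≤x x≤v → √-nonneg (P x) , λ e → w≉0 x u≤x x≤v (sym e)))
          where
          0≤P′ : NonnegOn u v P
          0≤P′ x u≤x x≤v = 0≤P x (≤-trans a≤u u≤x) (≤-trans x≤v v≤b)
          pointwise : ∀ x → 0# ≤ P x → ¬ (w x ≈ 0#) →
            P′ x * (w x + w x) ⁻¹ * H x
              + w x * ((nat n * F′ n (D x) * V m (D x) - nat m * F′ m (D x) * V n (D x)) * D′ x)
            ≈ Δ * (V n (D x) * V m (D x) * (w x) ⁻¹ * D′ x)
          -- Everything is brought over 1/w by means of w′ = - y y′ / w and w = P / w. After `pF′`,
          -- the terms with y cancel against those of w′ H, and (m² - n²) V n V m remains.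
          pointwise x 0≤Px w≉0 = trans
            (+-cong (*-congʳ lemma₁) (*-congʳ lemma₂))
            (trans (solve 6 (λ y y′ p i f v →
                  :- (y :* y′ :* i) :* v :+ p :* i :* (f :* y′) := y′ :* i :* (p :* f :- y :* v)) refl
                (D x) (D′ x) (P x) i
                (nat n * F′ n (D x) * V m (D x) - nat m * F′ m (D x) * V n (D x))
                (H x))
            (trans (*-congˡ (+-congʳ (solve 7 (λ p N M f′ g′ v₁ v →
                  p :* (N :* f′ :* v₁ :- M :* g′ :* v)
                    := N :* (p :* f′) :* v₁ :- M :* (p :* g′) :* v) refl
                (P x) (nat n) (nat m) (F′ n (D x)) (F′ m (D x)) (V m (D x)) (V n (D x)))))
            (trans (*-congˡ (+-congʳ (+-cong (*-congʳ (*-congˡ (pF′ n (D x))))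
                                             (-‿cong (*-congʳ (*-congˡ (pF′ m (D x))))))))
              (solve 9 (λ y y′ i N M f g v v₁ →
                  y′ :* i :* (N :* (y :* f :- N :* v) :* v₁ :- M :* (y :* g :- M :* v₁) :* v
                    :- y :* (N :* f :* v₁ :- M :* g :* v))
                  := (M :* M :- N :* N) :* (v :* v₁ :* i :* y′)) refl
                (D x) (D′ x) i (nat n) (nat m) (F n (D x)) (F m (D x)) (V n (D x)) (V m (D x))))))
            where
            i : Carrier
            i = (w x) ⁻¹
            w+w≉0 : ¬ (w x + w x ≈ 0#)
            w+w≉0 = pos⇒≉0 (+-pos (√-nonneg (P x) , λ e → w≉0 (sym e)) (√-nonneg (P x)))
            lemma₁ : P′ x * (w x + w x) ⁻¹ ≈ - (D x * D′ x * i)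
            lemma₁ = *-cancelˡ w+w≉0 (trans
              (solve 3 (λ z q j → z :* (q :* j) := q :* (z :* j)) refl (w x + w x) (P′ x) ((w x + w x) ⁻¹))
              (trans (*-congˡ (trans (⁻¹-inverseʳ w+w≉0) (sym (⁻¹-inverseʳ w≉0))))
                (solve 4 (λ y y′ w i → :- ((:1 :+ :1) :* y :* y′) :* (w :* i)
                  := (w :+ w) :* :- (y :* y′ :* i)) refl (D x) (D′ x) (w x) i)))
            lemma₂ : w x ≈ P x * i
            lemma₂ = trans (sym (*-identityʳ _)) (trans (*-congˡ (sym (⁻¹-inverseʳ w≉0)))
              (trans (sym (*-assoc _ _ _)) (*-congʳ (√-square 0≤Px))))
          fromBound : (∃[ c ] 0# < c × (∀ x → u ≤ x → x ≤ v → c ≤ w x)) →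
            Derivative u v Ψ (λ x → Δ * (V n (D x) * V m (D x) * (w x) ⁻¹ * D′ x))
          fromBound (c , 0<c , c≤w) = Derivative-cong (λ _ _ _ → refl)
            (λ x u≤x x≤v → pointwise x (0≤P′ x u≤x x≤v) (w≉0 x u≤x x≤v))
            (Derivative-* (Derivative-√ 0≤P′ 0<c c≤w Derivative-P) Derivative-H)

      module _ (a<b : a < b) (Pa≈0 : P a ≈ 0#) (Pb≈0 : P b ≈ 0#) (n≢m : n ≢ m) where

        abstract
          w-zero : ∀ {x} → P x ≈ 0# → w x ≈ 0#
          w-zero {x} Px≈0 with zero? (w x)
          ... | inj₁ e  = e
          ... | inj₂ ne = integral (trans (√-square (≤-reflexive (sym Px≈0))) Px≈0) ne

          increment-zero : ∀ {κ X Y} → X ≈ 0# → Y ≈ 0# → κ * X - κ * Y ≈ 0#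
          increment-zero {κ} X≈0 Y≈0 =
            trans (+-cong (*-congˡ X≈0) (-‿cong (*-congˡ Y≈0)))
              (trans (+-congˡ (-‿cong (zeroʳ κ))) (trans (+-congʳ (zeroʳ κ)) (-‿inverseʳ 0#)))

          Φ-zero : ∀ {x} → P x ≈ 0# → Φ x ≈ 0#
          Φ-zero Px≈0 = trans (*-congʳ (trans (*-congˡ (trans (*-congˡ Px≈0) (zeroʳ _))) (zeroʳ _)))
            (zeroˡ _)

          Ψ-zero : ∀ {x} → P x ≈ 0# → Ψ x ≈ 0#
          Ψ-zero Px≈0 = trans (*-congʳ (w-zero Px≈0)) (zeroˡ _)

          -- The constant 2 (m² - n²) is divided out of the antiderivative, so that its derivative
          -- is the integrand itself.
          fibonacci-orthogonal : Riemann
            (λ x → eval (fibonacci d (const k) n) x * eval (fibonacci d (const k) m) x * w x * D′ x)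
            a b 0#
          fibonacci-orthogonal = Riemann-resp (increment-zero (Φ-zero Pb≈0) (Φ-zero Pa≈0))
            (fundamental-theorem (<⇒≤ a<b) (Derivative-cong (λ _ _ _ → refl) integrand
              (Derivative-scale (((1# + 1#) * Δ) ⁻¹) Derivative-Φ)))
            where
            2Δ≉0 : ¬ ((1# + 1#) * Δ ≈ 0#)
            2Δ≉0 e = square-difference-≉0 n≢m (integral e (pos⇒≉0 0<2))
            integrand : EqualOn a b
              (λ x → ((1# + 1#) * Δ) ⁻¹ * ((1# + 1#) * Δ * (F n (D x) * F m (D x) * w x * D′ x)))
              (λ x → eval (fibonacci d (const k) n) x * eval (fibonacci d (const k) m) x * w x * D′ x)
            integrand x _ _ = trans (sym (*-assoc _ _ _))
              (trans (*-congʳ (trans (*-comm _ _) (⁻¹-inverseʳ 2Δ≉0)))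
                (trans (*-identityˡ _) (*-congʳ (*-congʳ
                  (sym (*-cong (eval-fibonacci n x) (eval-fibonacci m x)))))))

          lucas-orthogonal : ∀ {p₀ p₁} → (∀ x → (1# + 1#) * eval p₁ x ≈ p₀ * D x) →
            (q₁ q₂ : Poly) → (∀ x → eval q₁ x * eval q₂ x ≈ P x) →
            (∃[ z ] ¬ (eval q₁ z ≈ 0#)) → (∃[ z ] ¬ (eval q₂ z ≈ 0#)) →
            Improper (λ x → ¬ (w x ≈ 0#))
              (λ x → eval (lucas d (const k) p₀ p₁ n) x * eval (lucas d (const k) p₀ p₁ m) x
                       * (w x) ⁻¹ * D′ x) a b 0#
          lucas-orthogonal {p₀} {p₁} 2p₁ q₁ q₂ q₁q₂ q₁≉0 q₂≉0 =
            Improper-resp (increment-zero (Ψ-zero Pb≈0) (Ψ-zero Pa≈0))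
              (improper-fundamental-theorem q₁ q₂ q₁≉0 q₂≉0 w≉0 a<b
                (λ u v a≤u v≤b → Continuous-* (Continuous-const _) (Continuous-Ψ u v a≤u v≤b))
                (λ u v a≤u u≤v v≤b w≉0 → Derivative-cong (λ _ _ _ → refl) (λ x _ _ → integrand x)
                  (Derivative-scale (c * (p₀ * p₀)) (Derivative-Ψ u v a≤u u≤v v≤b w≉0))))
            where
            4Δ c : Carrier
            -- Replacing V by 2 𝓛 / p₀ in two factors produces 4 / p₀², so Ψ is scaled by p₀² / (4
            -- Δ).
            4Δ = (1# + 1#) * ((1# + 1#) * Δ)
            c = 4Δ ⁻¹
            L : ℕ → Carrier → Carrier
            L n x = eval (lucas d (const k) p₀ p₁ n) x
            4Δ≉0 : ¬ (4Δ ≈ 0#)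
            4Δ≉0 e = square-difference-≉0 n≢m
              (integral (integral e (pos⇒≉0 0<2)) (pos⇒≉0 0<2))
            w≉0 : ∀ x → a ≤ x → x ≤ b → ¬ (eval q₁ x ≈ 0#) → ¬ (eval q₂ x ≈ 0#) → ¬ (w x ≈ 0#)
            w≉0 x a≤x x≤b q₁x≉0 q₂x≉0 e = q₂x≉0 (integral (trans (q₁q₂ x)
              (trans (sym (√-square (0≤P x a≤x x≤b))) (trans (*-congʳ e) (zeroˡ _)))) q₁x≉0)
            integrand : ∀ x → c * (p₀ * p₀) * (Δ * (V n (D x) * V m (D x) * (w x) ⁻¹ * D′ x))
              ≈ L n x * L m x * (w x) ⁻¹ * D′ x
            integrand x = trans
              (solve 7 (λ c p e v v₁ i y′ → c :* (p :* p) :* (e :* (v :* v₁ :* i :* y′))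
                := c :* e :* ((p :* v) :* (p :* v₁)) :* i :* y′) refl
                c p₀ Δ (V n (D x)) (V m (D x)) ((w x) ⁻¹) (D′ x))
              (*-congʳ (*-congʳ (trans
                (*-congˡ (*-cong (sym (eval-lucas 2p₁ n x)) (sym (eval-lucas 2p₁ m x))))
                (trans (solve 4 (λ c e l l₁ → c :* e :* ((:1 :+ :1) :* l :* ((:1 :+ :1) :* l₁))
                    := (:1 :+ :1) :* ((:1 :+ :1) :* e) :* c :* (l :* l₁)) refl c Δ (L n x) (L m x))
                  (trans (*-congʳ (⁻¹-inverseʳ 4Δ≉0)) (*-identityˡ _))))))

proposition3p6 : (ℝ : Reals) →
    let open Reals ℝ
        open Analysis ℝ
    in
    (k : Carrier) → k < 0# →
    (dℚ : ℚ[x].Poly) → ℚ[x].NonConstant dℚ →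
    (p₀ : Carrier) →
    (p₀ ≈ 1# ⊎ p₀ ≈ - 1# ⊎ p₀ ≈ 2 · 1# ⊎ p₀ ≈ - (2 · 1#)) →
    (p₁ : Poly) →
    let d  = fromℚ[x] dℚ
        g  = const k
        α  = (2 · 1#) * p₀ ⁻¹
        𝓕  = fibonacci d g
        𝓛  = lucas d g p₀ p₁
        d′ = deriv d
        w  = λ x → √ (- (4 · k) - eval d x * eval d x)
    in
    d ≐ α ⊙ p₁ →
    (s₁ s₂ : Carrier) →
    eval d s₁ ≈ - (√ (- (4 · k))) →
    eval d s₂ ≈ √ (- (4 · k)) →
    (∀ x → Between s₁ s₂ x → 4 · k + eval d x * eval d x ≤ 0#) →
    (n m : ℕ) → n ≢ m →
    (∫[ s₁ , s₂ ] (λ x → eval (𝓕 n) x * eval (𝓕 m) x * w x * eval d′ x) ≈ 0#)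
    ×
    (∫[ s₁ , s₂ ] (λ x → eval (𝓛 n) x * eval (𝓛 m) x * (w x) ⁻¹ * eval d′ x)
      off-zeros-of w ≈ 0#)
proposition3p6 ℝ k k<0 dℚ _ p₀ p₀∈ p₁ d≐αp₁ s₁ s₂ ds₁ ds₂ bound n m n≢m =
  oriented (total s₁ s₂)
  where
  open Reals ℝ hiding (zero)
  open Analysis ℝ
  open RingSolver commutativeRing
  open OrderedField ℝ
  open Completeness ℝ
  open Differentiation ℝ
  open Partition ℝ
  open Orthogonality ℝ

  d : Poly
  d = fromℚ[x] dℚ

  open Weight k d

  r : Carrier
  r = √ (- (4 · k))

  0<-4k : 0# < - (4 · k)
  0<-4k = <-respʳ-≈ (solve 1 (λ k → (:0 :- k) :+ (:0 :- k) :+ (:0 :- k) :+ (:0 :- k) := :- (4 :· k)) refl k)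
    (+-pos (+-pos (+-pos 0<-k (<⇒≤ 0<-k)) (<⇒≤ 0<-k)) (<⇒≤ 0<-k))
    where
    0<-k : 0# < 0# - k
    0<-k = x<y⇒0<y-x k<0

  r² : r * r ≈ - (4 · k)
  r² = √-square (<⇒≤ 0<-4k)

  0<r : 0# < r
  0<r = √-nonneg _ , λ e → pos⇒≉0 0<-4k (trans (sym r²) (trans (*-congʳ (sym e)) (zeroˡ r)))

  0<r+r : 0# < r + r
  0<r+r = +-pos 0<r (<⇒≤ 0<r)

  p₀≉0 : ¬ (p₀ ≈ 0#)
  p₀≉0 e = cases p₀∈
    where
    2≉0 : ¬ (2 · 1# ≈ 0#)
    2≉0 z = pos⇒≉0 0<2 (trans (+-congˡ (sym (+-identityʳ 1#))) z)
    negate : ∀ {x} → p₀ ≈ - x → x ≈ 0#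
    negate {x} q = trans (solve 1 (λ x → x := :0 :- (:- x)) refl x)
      (trans (+-congˡ (-‿cong (trans (sym q) e))) (-‿inverseʳ 0#))
    cases : p₀ ≈ 1# ⊎ p₀ ≈ - 1# ⊎ p₀ ≈ 2 · 1# ⊎ p₀ ≈ - (2 · 1#) → ⊥
    cases (inj₁ q)               = 1≉0 (trans (sym q) e)
    cases (inj₂ (inj₁ q))        = 1≉0 (negate q)
    cases (inj₂ (inj₂ (inj₁ q))) = 2≉0 (trans (sym q) e)
    cases (inj₂ (inj₂ (inj₂ q))) = 2≉0 (negate q)

  2p₁ : ∀ x → (1# + 1#) * eval p₁ x ≈ p₀ * D x
  2p₁ x = sym (trans (*-congˡ (trans (eval-≐ d (((2 · 1#) * p₀ ⁻¹) ⊙ p₁) d≐αp₁ x) (eval-⊙ _ p₁ x)))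
    (trans (solve 3 (λ p i e → p :* (2 :· :1 :* i :* e) := p :* i :* ((:1 :+ :1) :* e)) refl
        p₀ (p₀ ⁻¹) (eval p₁ x))
      (trans (*-congʳ (⁻¹-inverseʳ p₀≉0)) (*-identityˡ _))))

  -- The factors r + d and r - d of P. Each is nonzero at the endpoint where the other vanishes;
  -- kept apart, they are seen to be nonzero without a point where both are.
  q₁ q₂ : Poly
  q₁ = const r ⊞ d
  q₂ = const r ⊞ ((- 1#) ⊙ d)

  eval-q₁ : ∀ x → eval q₁ x ≈ r + D x
  eval-q₁ x = trans (eval-⊞ (const r) d x) (+-congʳ (eval-const r x))

  eval-q₂ : ∀ x → eval q₂ x ≈ r - D x
  eval-q₂ x = trans (eval-⊞ (const r) ((- 1#) ⊙ d) x) (+-cong (eval-const r x)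
    (trans (eval-⊙ (- 1#) d x) (solve 1 (λ y → :- :1 :* y := :- y) refl (D x))))

  q₁q₂ : ∀ x → eval q₁ x * eval q₂ x ≈ P x
  q₁q₂ x = trans (*-cong (eval-q₁ x) (eval-q₂ x))
    (trans (solve 2 (λ r y → (r :+ y) :* (r :- y) := r :* r :- y :* y) refl r (D x)) (+-congʳ r²))

  q₁≉0 : ∃[ z ] ¬ (eval q₁ z ≈ 0#)
  q₁≉0 = s₂ , λ e → pos⇒≉0 0<r+r (trans (+-congˡ (sym ds₂)) (trans (sym (eval-q₁ s₂)) e))

  q₂≉0 : ∃[ z ] ¬ (eval q₂ z ≈ 0#)
  q₂≉0 = s₁ , λ e → pos⇒≉0 0<r+r (trans (solve 1 (λ r → r :+ r := r :- :- r) refl r)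
    (trans (+-congˡ (-‿cong (sym ds₁))) (trans (sym (eval-q₂ s₁)) e)))

  Ps₁≈0 : P s₁ ≈ 0#
  Ps₁≈0 = trans (+-cong (sym r²) (-‿cong (*-cong ds₁ ds₁)))
    (solve 1 (λ r → r :* r :- :- r :* :- r := :0) refl r)

  Ps₂≈0 : P s₂ ≈ 0#
  Ps₂≈0 = trans (+-cong (sym r²) (-‿cong (*-cong ds₂ ds₂))) (-‿inverseʳ _)

  -- The values -r and r of d differ. This gives the strict inequality of the endpoints from which
  -- the cutting into open intervals starts.
  s₁≉s₂ : ¬ (s₁ ≈ s₂)
  s₁≉s₂ e = pos⇒≉0 0<r+r (trans (+-congˡ (trans (sym ds₂) (trans (eval-cong d (sym e)) ds₁)))
    (-‿inverseʳ r))

  0≤P : ∀ x → Between s₁ s₂ x → 0# ≤ P x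
  0≤P x s = by-≤ (x≤y⇒0≤y-x (bound x s))
    (solve 2 (λ c y → :- c :- y :* y :- :0 := :0 :- (c :+ y :* y)) refl (4 · k) (D x))

  oriented : s₁ ≤ s₂ ⊎ s₂ ≤ s₁ → _ × _
  oriented (inj₁ s₁≤s₂) =
    inj₁ (s₁≤s₂ , fibonacci-orthogonal (s₁≤s₂ , s₁≉s₂) Ps₁≈0 Ps₂≈0 n≢m) ,
    inj₁ (s₁≤s₂ , lucas-orthogonal (s₁≤s₂ , s₁≉s₂) Ps₁≈0 Ps₂≈0 n≢m 2p₁ q₁ q₂ q₁q₂ q₁≉0 q₂≉0)
    where open Interval s₁ s₂ (λ x p q → 0≤P x (inj₁ (p , q))) n m
  oriented (inj₂ s₂≤s₁) =
    -- Reversed orientation asks for the negated value, here - 0.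
    inj₂ (s₂≤s₁ , Riemann-resp 0≈-0
      (fibonacci-orthogonal (s₂≤s₁ , s₂≉s₁) Ps₂≈0 Ps₁≈0 n≢m)) ,
    inj₂ (s₂≤s₁ , Improper-resp 0≈-0
      (lucas-orthogonal (s₂≤s₁ , s₂≉s₁) Ps₂≈0 Ps₁≈0 n≢m 2p₁ q₁ q₂ q₁q₂ q₁≉0 q₂≉0))
    where
    open Interval s₂ s₁ (λ x p q → 0≤P x (inj₂ (p , q))) n m
    s₂≉s₁ : ¬ (s₂ ≈ s₁)
    s₂≉s₁ e = s₁≉s₂ (sym e)
    0≈-0 : 0# ≈ - 0#
    0≈-0 = solve 0 (:0 := :- :0) refl
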